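{- Let $\theta>2$ be a non-integer real number and let $\tau>0$. Let $s\ge 2$ be an integer and let $c$ be a fixed real constant with $0\le c<(\lfloor s/2\rfloor(\theta-1))^{ -1/2}$. Then there exists an infinite strictly increasing sequence of non-negative real numbers $\{R_n\}_{n=1}^\infty$ with $R_n\to\infty$ as $n\to\infty$ such that, with $X_n=(R_n/s)^{1/\theta}$, $$N_{s,\theta}^{\tau}(R_n,c\sqrt{X_n})=0\quad\text{for every } n.$$
   Context: For $s\in\mathbb{N}$, $\theta>2$ non-integer, $\tau>0$, $R>0$ real, $X=(R/s)^{1/\theta}$ and $0\le Y\le X$, the quantity $N_{s,\theta}^{\tau}(R,Y)$ is the number of $s$-tuples of positive integers $(x_1,\ldots,x_s)$ satisfying $$|x_1^\theta+\cdots+x_s^\theta-R|<\tau \quad\text{and}\quad X-Y<x_i\le X+Y\quad (1\le i\le s).$$ (When $Y=c\sqrt X$ with $c$ fixed, the condition $Y\le X$ holds for all large $R$.) -}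

module Defs where

open import Algebra.Bundles using (CommutativeRing; Semiring)
import Algebra.Definitions.RawSemiring as RawSemiringDefinitions
open import Data.Integer.Base using (ℤ; +_; -[1+_])
open import Data.List.Base using (List; length)
open import Data.List.Membership.Propositional using (_∈_)
open import Data.List.Relation.Unary.Unique.Propositional using (Unique)
open import Data.Nat.Base as ℕ using (ℕ; suc)
open import Data.Product.Base using (Σ-syntax; ∃; ∃-syntax; _×_)
open import Data.Vec.Base using (Vec; lookup)
open import Function.Bundles using (_⇔_)
open import Level using (0ℓ)
open import Relation.Binary.Core using (Rel)
open import Relation.Binary.Definitions using (tri<; tri≈; tri>)
import Relation.Binary.Construct.StrictToNonStrict as StrictToNonStrict
open import Relation.Binary.PropositionalEquality.Core using (_≡_)
open import Relation.Binary.Structures using (IsStrictTotalOrder)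
open import Relation.Nullary.Negation.Core using (¬_)
open import Relation.Unary using (Pred; Satisfiable)

-- The classical real numbers, given by the axioms that determine them up to
-- isomorphism.  As usual, _⁻¹ and sup are total operations about which nothing
-- is assumed at 0, respectively at sets that are empty or unbounded above.
record CompleteOrderedField : Set₁ where
  infix  8 _⁻¹
  infix  4 _<_ _≤_

  field
    commutativeRing : CommutativeRing 0ℓ 0ℓ

  open CommutativeRing commutativeRing public

  field
    1≉0        : ¬ (1# ≈ 0#)
    _⁻¹        : Carrier → Carrier
    ⁻¹-cong    : ∀ {x y} → x ≈ y → x ⁻¹ ≈ y ⁻¹
    *-inverseʳ : ∀ x → ¬ (x ≈ 0#) → x * x ⁻¹ ≈ 1#

    _<_                : Rel Carrier 0ℓ
    isStrictTotalOrder : IsStrictTotalOrder _≈_ _<_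
    +-monoˡ-<          : ∀ z {x y} → x < y → x + z < y + z
    *-positive         : ∀ {x y} → 0# < x → 0# < y → 0# < x * y

  _≤_ : Rel Carrier 0ℓ
  _≤_ = StrictToNonStrict._≤_ _≈_ _<_

  UpperBound : Pred Carrier 0ℓ → Pred Carrier 0ℓ
  UpperBound P u = ∀ y → P y → y ≤ u

  -- No number below a supremum is an upper bound, "not an upper bound" being
  -- witnessed by an element that exceeds it.
  IsSupremum : Pred Carrier 0ℓ → Pred Carrier 0ℓ
  IsSupremum P u = UpperBound P u × (∀ y → y < u → ∃[ z ] (P z × y < z))

  field
    sup            : Pred Carrier 0ℓ → Carrier
    sup-isSupremum : ∀ P → Satisfiable P → Satisfiable (UpperBound P) →
                     IsSupremum P (sup P)

module RealNumbers (ℝ : CompleteOrderedField) where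
  open CompleteOrderedField ℝ public
  open IsStrictTotalOrder isStrictTotalOrder public using (compare)
  open RawSemiringDefinitions (Semiring.rawSemiring semiring) public
    using (_^_; sum) renaming (_×_ to _·_)

  infixl 7 _÷_
  infixr 8 _**_

  fromℕ : ℕ → Carrier
  fromℕ n = n · 1#

  fromℤ : ℤ → Carrier
  fromℤ (+ n)    = fromℕ n
  fromℤ -[1+ n ] = - fromℕ (suc n)

  NonInteger : Pred Carrier 0ℓ
  NonInteger x = ∀ k → ¬ (x ≈ fromℤ k)

  _÷_ : Carrier → Carrier → Carrier
  x ÷ y = x * y ⁻¹

  ½ : Carrier
  ½ = 1# ÷ fromℕ 2

  ∣_∣ : Carrier → Carrier
  ∣ x ∣ with compare x 0#
  ... | tri< _ _ _ = - x
  ... | tri≈ _ _ _ = x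
  ... | tri> _ _ _ = x

  -- For b ≥ 1: the t ≥ 0 with t ≤ b^r for some rational r = (p - q)/(1 + n)
  -- such that r ≤ x, with denominators and negative exponents cleared.
  BelowPower : Carrier → Carrier → Pred Carrier 0ℓ
  BelowPower b x t =
    ∃[ p ] ∃[ q ] Σ[ n ∈ ℕ ]
      (fromℕ p - fromℕ q ≤ fromℕ (suc n) * x
       × 0# ≤ t
       × t ^ suc n * b ^ q ≤ b ^ p)

  -- Real exponentiation: b^x = sup { b^r : r rational, r ≤ x } for b ≥ 1, and
  -- b^x = (b⁻¹)^(-x) for 0 < b < 1.  The value at b ≤ 0 is 0, which is correct
  -- for b = 0 and x > 0; the other cases are conventional.
  _**_ : Carrier → Carrier → Carrier
  b ** x with compare 0# b | compare b 1#
  ... | tri< _ _ _ | tri< _ _ _ = sup (BelowPower (b ⁻¹) (- x))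
  ... | tri< _ _ _ | tri≈ _ _ _ = sup (BelowPower b x)
  ... | tri< _ _ _ | tri> _ _ _ = sup (BelowPower b x)
  ... | tri≈ _ _ _ | _          = 0#
  ... | tri> _ _ _ | _          = 0#

  √ : Carrier → Carrier
  √ x = x ** ½

  StrictlyIncreasing : (ℕ → Carrier) → Set
  StrictlyIncreasing R = ∀ n → R n < R (suc n)

  TendsToInfinity : (ℕ → Carrier) → Set
  TendsToInfinity R = ∀ B → Σ[ m ∈ ℕ ] (∀ n → m ℕ.≤ n → B < R n)

  HasCardinality : {A : Set} → Pred A 0ℓ → ℕ → Set
  HasCardinality {A} P k =
    Σ[ xs ∈ List A ] (Unique xs × (∀ x → x ∈ xs ⇔ P x) × length xs ≡ k)

  -- X = (R/s)^(1/θ)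
  centre : ℕ → Carrier → Carrier → Carrier
  centre s θ R = (R ÷ fromℕ s) ** (1# ÷ θ)

  IsSolution : (s : ℕ) (θ τ R Y : Carrier) → Pred (Vec ℕ s) 0ℓ
  IsSolution s θ τ R Y x =
    (∀ i → 0 ℕ.< lookup x i)
    × ∣ sum (λ i → fromℕ (lookup x i) ** θ) - R ∣ < τ
    × (∀ i → X - Y < fromℕ (lookup x i) × fromℕ (lookup x i) ≤ X + Y)
    where X = centre s θ R

  -- N s θ τ R Y k says that the number N_{s,θ}^τ(R,Y) is k.
  N : (s : ℕ) (θ τ R Y : Carrier) → ℕ → Set
  N s θ τ R Y = HasCardinality (IsSolution s θ τ R Y)

{-# OPTIONS --safe #-}
module Submission where

-- Write hᵢ = xᵢ - X and Y = c√X, so that |hᵢ| ≤ Y for a solution.  Taylor's formula gives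
--   Σxᵢ^θ - R ≈ θ X^(θ-1) (Σhᵢ + (θ-1)/(2X) Σhᵢ²).
-- Put κ = ⌊s/2⌋(θ-1)c² < 1 and δ = (1-κ)/2, and choose R so that sX lies δ below an integer;
-- then Σhᵢ ∈ δ + ℤ.  If Σhᵢ ≥ δ, convexity alone gives Σxᵢ^θ - R ≥ θ X^(θ-1) δ, which is large.
-- Otherwise Σhᵢ ≤ δ - 1.  Positive and negative hᵢ nearly balance, and one of the two signs
-- occurs at most ⌊s/2⌋ times, whence Σhᵢ² ≤ Y(2⌊s/2⌋Y + |Σhᵢ|).  So the quadratic term is
-- essentially at most κ < 1 - δ and cannot make up for Σhᵢ.
--
-- The analysis needed is the tangent inequality for x^θ and its second-order counterpart.  The
-- former is Bernoulli's inequality for real exponents, obtained from integer exponents by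
-- passing to N-th roots; the latter follows from tangents to x^θ and x^(θ-1) by subdividing the
-- interval from X to x into N steps and letting N → ∞.

open import Defs
import Algebra.Properties.CommutativeSemiring.Exp as CommutativeSemiringExp
import Algebra.Properties.Monoid.Mult as MonoidMult
import Algebra.Properties.Ring as RingProperties
import Algebra.Properties.Semiring.Exp as SemiringExp
import Algebra.Properties.Semiring.Mult as SemiringMult
import Algebra.Solver.Ring as RingSolver
open import Algebra.Solver.Ring.AlmostCommutativeRing using (fromCommutativeRing; _-Raw-AlmostCommutative⟶_)
open import Data.Fin.Base using (Fin; zero; suc)
open import Data.Integer.Base as ℤ using (ℤ; +_; -[1+_])
import Data.Integer.Properties as ℤ
open import Data.List.Base using ([])
open import Data.List.Relation.Unary.AllPairs using ([])
open import Data.Maybe.Base as Maybe using (Maybe)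
open import Data.Nat.Base as ℕ using (ℕ; zero; suc; ⌊_/2⌋)
import Data.Nat.Properties as ℕ
open import Data.Product.Base using (Σ-syntax; ∃; ∃-syntax; _×_; _,_; proj₁; proj₂)
open import Data.Sum.Base using (_⊎_; inj₁; inj₂)
open import Data.Vec.Base using (lookup)
open import Function.Bundles using (mk⇔)
open import Level using (0ℓ)
open import Relation.Binary.Bundles using (StrictTotalOrder; DecTotalOrder)
open import Relation.Binary.Definitions using (tri<; tri≈; tri>)
import Relation.Binary.Properties.StrictTotalOrder as StrictTotalOrderProperties
import Relation.Binary.Reasoning.Setoid as SetoidReasoning
import Relation.Binary.Reasoning.StrictPartialOrder as StrictPartialOrderReasoning
open import Relation.Binary.PropositionalEquality.Core as ≡ using (_≡_)
open import Relation.Nullary.Decidable.Core using (Dec; yes; no)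
open import Relation.Nullary.Decidable using (dec⇒maybe)
open import Relation.Nullary.Negation.Core using (¬_; contradiction)

-- The value of δ equalises the margins of the two cases: the first has δ to spare and the second 1
-- - κ - δ, and δ is the midpoint of the interval from 0 to 1 - κ. The remaining errors have
-- relative size Y/X, of order 1/√X, so they are absorbed once X is large. R is built from X,
-- because the residue of sX modulo 1 has to be prescribed. The price is that the centre, itself a
-- real power of R/s, must afterwards be recognised as X. The axioms provide no calculus, and `_**_`
-- is a supremum over rational exponents with cleared denominators. Powers are therefore handled
-- through an order characterisation by rational comparisons, for bases at least 1 only. This
-- suffices: all xᵢ, X, X + Y and ⌊s/2⌋(θ-1) are at least 1, and quotients are always taken larger
-- over smaller.

module _ (ℝ : CompleteOrderedField) where
  open RealNumbers ℝ hiding (N; zero)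

  open MonoidMult +-monoid using (×-homo-+)
  open SemiringMult semiring using (×1-homo-*)
  open RingProperties ring using (-‿+-comm; -‿involutive; -0#≈0#; -‿distribˡ-*; -‿distribʳ-*)

  fromℕ-+ : ∀ m n → fromℕ (m ℕ.+ n) ≈ fromℕ m + fromℕ n
  fromℕ-+ = ×-homo-+ 1#

  fromℕ-* : ∀ m n → fromℕ (m ℕ.* n) ≈ fromℕ m * fromℕ n
  fromℕ-* = ×1-homo-*

  module ≈-Reasoning = SetoidReasoning setoid

  -- Integer coefficients for the ring solver

  private
    module IntegerCoefficients where
      open ≈-Reasoning

      fromℤ-⊖ : ∀ m n → fromℤ (m ℤ.⊖ n) ≈ fromℕ m - fromℕ n
      fromℤ-⊖ m       zero    = sym (trans (+-congˡ -0#≈0#) (+-identityʳ _))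
      fromℤ-⊖ zero    (suc n) = sym (+-identityˡ _)
      fromℤ-⊖ (suc m) (suc n) = begin
        fromℤ (suc m ℤ.⊖ suc n)                 ≡⟨ ≡.cong fromℤ (ℤ.[1+m]⊖[1+n]≡m⊖n m n) ⟩
        fromℤ (m ℤ.⊖ n)                         ≈⟨ fromℤ-⊖ m n ⟩
        fromℕ m - fromℕ n                       ≈⟨ +-congʳ (+-identityˡ _) ⟨
        0# + fromℕ m - fromℕ n                  ≈⟨ +-congʳ (+-congʳ (-‿inverseʳ 1#)) ⟨
        1# - 1# + fromℕ m - fromℕ n
          ≈⟨ +-congʳ (trans (+-assoc _ _ _) (trans (+-congˡ (+-comm _ _)) (sym (+-assoc _ _ _)))) ⟩
        1# + fromℕ m - 1# - fromℕ n             ≈⟨ +-assoc _ _ _ ⟩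
        1# + fromℕ m + (- 1# - fromℕ n)         ≈⟨ +-congˡ (-‿+-comm _ _) ⟩
        fromℕ (suc m) - fromℕ (suc n)           ∎

      fromℤ-+ : ∀ i j → fromℤ (i ℤ.+ j) ≈ fromℤ i + fromℤ j
      fromℤ-+ (+ m)    (+ n)    = fromℕ-+ m n
      fromℤ-+ (+ m)    -[1+ n ] = fromℤ-⊖ m (suc n)
      fromℤ-+ -[1+ m ] (+ n)    = trans (fromℤ-⊖ n (suc m)) (+-comm _ _)
      fromℤ-+ -[1+ m ] -[1+ n ] = begin
        - fromℕ (suc (suc (m ℕ.+ n)))           ≡⟨ ≡.cong (λ k → - fromℕ (suc k)) (ℕ.+-suc m n) ⟨
        - fromℕ (suc m ℕ.+ suc n)               ≈⟨ -‿cong (fromℕ-+ (suc m) (suc n)) ⟩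
        - (fromℕ (suc m) + fromℕ (suc n))       ≈⟨ -‿+-comm _ _ ⟨
        - fromℕ (suc m) - fromℕ (suc n)         ∎

      fromℤ-neg : ∀ i → fromℤ (ℤ.- i) ≈ - fromℤ i
      fromℤ-neg (+ zero)  = sym -0#≈0#
      fromℤ-neg (+ suc n) = refl
      fromℤ-neg -[1+ n ]  = sym (-‿involutive _)

      fromℤ-+* : ∀ m j → fromℤ (+ m ℤ.* j) ≈ fromℕ m * fromℤ j
      fromℤ-+* m (+ n)    = begin
        fromℤ (+ m ℤ.* + n)                     ≡⟨ ≡.cong fromℤ (ℤ.pos-* m n) ⟨
        fromℕ (m ℕ.* n)                         ≈⟨ fromℕ-* m n ⟩
        fromℕ m * fromℕ n                       ∎
      fromℤ-+* m -[1+ n ] = begin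
        fromℤ (+ m ℤ.* ℤ.- (+ suc n))           ≡⟨ ≡.cong fromℤ (ℤ.neg-distribʳ-* (+ m) (+ suc n)) ⟨
        fromℤ (ℤ.- (+ m ℤ.* + suc n))           ≈⟨ fromℤ-neg (+ m ℤ.* + suc n) ⟩
        - fromℤ (+ m ℤ.* + suc n)               ≈⟨ -‿cong (fromℤ-+* m (+ suc n)) ⟩
        - (fromℕ m * fromℕ (suc n))             ≈⟨ -‿distribʳ-* _ _ ⟩
        fromℕ m * - fromℕ (suc n)               ∎

      fromℤ-* : ∀ i j → fromℤ (i ℤ.* j) ≈ fromℤ i * fromℤ j
      fromℤ-* (+ m)    j = fromℤ-+* m j
      fromℤ-* -[1+ m ] j = begin
        fromℤ (ℤ.- (+ suc m) ℤ.* j)             ≡⟨ ≡.cong fromℤ (ℤ.neg-distribˡ-* (+ suc m) j) ⟨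
        fromℤ (ℤ.- (+ suc m ℤ.* j))             ≈⟨ fromℤ-neg (+ suc m ℤ.* j) ⟩
        - fromℤ (+ suc m ℤ.* j)                 ≈⟨ -‿cong (fromℤ-+* (suc m) j) ⟩
        - (fromℕ (suc m) * fromℤ j)             ≈⟨ -‿distribˡ-* _ _ ⟩
        - fromℕ (suc m) * fromℤ j               ∎

      -- Sends 1 to 1# itself rather than to 1# + 0#, so that the constant 1 of
      -- the solver denotes 1#.
      ⟦_⟧ℤ : ℤ → Carrier
      ⟦ + 1 ⟧ℤ = 1#
      ⟦ i   ⟧ℤ = fromℤ i

      ⟦⟧ℤ≈fromℤ : ∀ i → ⟦ i ⟧ℤ ≈ fromℤ i
      ⟦⟧ℤ≈fromℤ (+ 0)             = refl
      ⟦⟧ℤ≈fromℤ (+ 1)             = sym (+-identityʳ 1#)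
      ⟦⟧ℤ≈fromℤ (+ suc (suc n))   = refl
      ⟦⟧ℤ≈fromℤ -[1+ n ]          = refl

      coefficients : ℤ.+-*-rawRing -Raw-AlmostCommutative⟶ fromCommutativeRing commutativeRing
      coefficients = record
        { ⟦_⟧    = ⟦_⟧ℤ
        ; +-homo = λ i j → via (i ℤ.+ j) (fromℤ-+ i j) (+-cong (⟦⟧ℤ≈fromℤ i) (⟦⟧ℤ≈fromℤ j))
        ; *-homo = λ i j → via (i ℤ.* j) (fromℤ-* i j) (*-cong (⟦⟧ℤ≈fromℤ i) (⟦⟧ℤ≈fromℤ j))
        ; -‿homo = λ i → via (ℤ.- i) (fromℤ-neg i) (-‿cong (⟦⟧ℤ≈fromℤ i))
        ; 0-homo = refl
        ; 1-homo = refl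
        }
        where
        via : ∀ i {x y} → fromℤ i ≈ x → y ≈ x → ⟦ i ⟧ℤ ≈ y
        via i i≈x y≈x = trans (⟦⟧ℤ≈fromℤ i) (trans i≈x (sym y≈x))

      coefficient≟ : ∀ i j → Maybe (⟦ i ⟧ℤ ≈ ⟦ j ⟧ℤ)
      coefficient≟ i j = Maybe.map (λ i≡j → reflexive (≡.cong ⟦_⟧ℤ i≡j)) (dec⇒maybe (i ℤ.≟ j))

    open IntegerCoefficients using (coefficients; coefficient≟)

  open RingSolver ℤ.+-*-rawRing (fromCommutativeRing commutativeRing) coefficients coefficient≟
    public
    using (solve; _:=_; con; _:+_; _:*_; _:-_; :-_; Polynomial)

  :0 : ∀ {n} → Polynomial n
  :0 = con (+ 0)

  :1 : ∀ {n} → Polynomial n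
  :1 = con (+ 1)

  -- Ordered field arithmetic

  strictTotalOrder : StrictTotalOrder 0ℓ 0ℓ 0ℓ
  strictTotalOrder = record { isStrictTotalOrder = isStrictTotalOrder }

  open StrictTotalOrder strictTotalOrder
    using (<-respˡ-≈; <-respʳ-≈; strictPartialOrder)
    renaming (trans to <-trans; irrefl to <-irrefl)
  open DecTotalOrder (StrictTotalOrderProperties.decTotalOrder strictTotalOrder)
    using (≤-respˡ-≈; ≤-respʳ-≈)
    renaming (refl to ≤-refl; trans to ≤-trans; antisym to ≤-antisym; total to ≤-total)

  <⊎≥ : ∀ x y → x < y ⊎ y ≤ x
  <⊎≥ x y with compare x y
  ... | tri< x<y _ _ = inj₁ x<y
  ... | tri≈ _ x≈y _ = inj₂ (inj₂ (sym x≈y))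
  ... | tri> _ _ y<x = inj₂ (inj₁ y<x)

  <-≤-trans : ∀ {x y z} → x < y → y ≤ z → x < z
  <-≤-trans x<y (inj₁ y<z) = <-trans x<y y<z
  <-≤-trans x<y (inj₂ y≈z) = <-respʳ-≈ y≈z x<y

  ≤-<-trans : ∀ {x y z} → x ≤ y → y < z → x < z
  ≤-<-trans (inj₁ x<y) y<z = <-trans x<y y<z
  ≤-<-trans (inj₂ x≈y) y<z = <-respˡ-≈ (sym x≈y) y<z

  ≤⇒≯ : ∀ {x y} → x ≤ y → ¬ (y < x)
  ≤⇒≯ x≤y y<x = <-irrefl refl (≤-<-trans x≤y y<x)

  ≮⇒≥ : ∀ {x y} → ¬ (x < y) → y ≤ x
  ≮⇒≥ {x} {y} x≮y with <⊎≥ x y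
  ... | inj₁ x<y = contradiction x<y x≮y
  ... | inj₂ y≤x = y≤x

  0<Δ : ∀ {x y} → x < y → 0# < y - x
  0<Δ {x} x<y = <-respˡ-≈ (-‿inverseʳ x) (+-monoˡ-< (- x) x<y)

  0≤Δ : ∀ {x y} → x ≤ y → 0# ≤ y - x
  0≤Δ (inj₁ x<y)     = inj₁ (0<Δ x<y)
  0≤Δ {x} (inj₂ x≈y) = inj₂ (trans (sym (-‿inverseʳ x)) (+-congʳ x≈y))

  -- Most inequalities below are proved in this form: the difference of the two sides is written as
  -- a visibly positive combination of known quantities, and the ring solver checks the identity.
  <-cert : ∀ {x y e} → 0# < e → y - x ≈ e → x < y
  <-cert {x} {y} {e} 0<e y-x≈e = <-respʳ-≈ e+x≈y (<-respˡ-≈ (+-identityˡ x) (+-monoˡ-< x 0<e))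
    where
    e+x≈y : e + x ≈ y
    e+x≈y = trans (+-congʳ (sym y-x≈e)) (solve 2 (λ x y → y :- x :+ x := y) refl x y)

  ≤-cert : ∀ {x y e} → 0# ≤ e → y - x ≈ e → x ≤ y
  ≤-cert (inj₁ 0<e) y-x≈e = inj₁ (<-cert 0<e y-x≈e)
  ≤-cert {x} {y} (inj₂ 0≈e) y-x≈e = inj₂ (begin
    x              ≈⟨ +-identityˡ x ⟨
    0# + x         ≈⟨ +-congʳ (trans 0≈e (sym y-x≈e)) ⟩
    y - x + x      ≈⟨ solve 2 (λ x y → y :- x :+ x := y) refl x y ⟩
    y              ∎)
    where open ≈-Reasoning

  infixl 6 _+>0_ _+≥0_
  infixl 7 _*>0_ _*≥0_

  _+>0_ : ∀ {x y} → 0# < x → 0# ≤ y → 0# < x + y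
  _+>0_ {x} {y} 0<x 0≤y = <-≤-trans 0<x (≤-cert 0≤y (solve 2 (λ x y → x :+ y :- x := y) refl x y))

  _+≥0_ : ∀ {x y} → 0# ≤ x → 0# ≤ y → 0# ≤ x + y
  _+≥0_ {x} {y} 0≤x 0≤y = ≤-trans 0≤x (≤-cert 0≤y (solve 2 (λ x y → x :+ y :- x := y) refl x y))

  _*>0_ : ∀ {x y} → 0# < x → 0# < y → 0# < x * y
  _*>0_ = *-positive

  _*≥0_ : ∀ {x y} → 0# ≤ x → 0# ≤ y → 0# ≤ x * y
  inj₁ 0<x *≥0 inj₁ 0<y = inj₁ (0<x *>0 0<y)
  _*≥0_ {x} {y} (inj₁ _) (inj₂ 0≈y) = inj₂ (sym (trans (*-congˡ (sym 0≈y)) (zeroʳ x)))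
  _*≥0_ {x} {y} (inj₂ 0≈x) _ = inj₂ (sym (trans (*-congʳ (sym 0≈x)) (zeroˡ y)))

  0≤-x : ∀ {x} → x ≤ 0# → 0# ≤ - x
  0≤-x {x} x≤0 = ≤-respʳ-≈ (+-identityˡ (- x)) (0≤Δ x≤0)

  square≥0 : ∀ x → 0# ≤ x * x
  square≥0 x with ≤-total 0# x
  ... | inj₁ 0≤x = 0≤x *≥0 0≤x
  ... | inj₂ x≤0 = ≤-respʳ-≈ (solve 1 (λ x → :- x :* :- x := x :* x) refl x) (0≤-x x≤0 *≥0 0≤-x x≤0)

  0≤1 : 0# ≤ 1#
  0≤1 = ≤-respʳ-≈ (*-identityˡ 1#) (square≥0 1#)

  0<1 : 0# < 1#
  0<1 with 0≤1
  ... | inj₁ 0<1 = 0<1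
  ... | inj₂ 0≈1 = contradiction (sym 0≈1) 1≉0

  x-1<x : ∀ x → x - 1# < x
  x-1<x x = <-cert 0<1 (solve 1 (λ x → x :- (x :- :1) := :1) refl x)

  fromℕ≥0 : ∀ n → 0# ≤ fromℕ n
  fromℕ≥0 zero    = ≤-refl
  fromℕ≥0 (suc n) = 0≤1 +≥0 fromℕ≥0 n

  fromℕ-suc>0 : ∀ n → 0# < fromℕ (suc n)
  fromℕ-suc>0 n = 0<1 +>0 fromℕ≥0 n

  fromℕ-mono-≤ : ∀ {m n} → m ℕ.≤ n → fromℕ m ≤ fromℕ n
  fromℕ-mono-≤ {n = n} ℕ.z≤n = fromℕ≥0 n
  fromℕ-mono-≤ {suc m} {suc n} (ℕ.s≤s m≤n) =
    ≤-cert (0≤Δ (fromℕ-mono-≤ m≤n))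
      (solve 2 (λ m n → :1 :+ n :- (:1 :+ m) := n :- m) refl (fromℕ m) (fromℕ n))

  fromℕ-cancel-≤ : ∀ {m n} → fromℕ m ≤ fromℕ n → m ℕ.≤ n
  fromℕ-cancel-≤ {m} {n} m≤n with ℕ.≤-<-connex m n
  ... | inj₁ p   = p
  ... | inj₂ n<m =
      contradiction
        (<-≤-trans (<-cert 0<1 (solve 1 (λ n → :1 :+ n :- n := :1) refl (fromℕ n)))
          (fromℕ-mono-≤ n<m)) (≤⇒≯ m≤n)

  *-monoˡ-≤ : ∀ {x y z} → 0# ≤ z → x ≤ y → z * x ≤ z * y
  *-monoˡ-≤ {x} {y} {z} 0≤z x≤y = ≤-cert (0≤z *≥0 0≤Δ x≤y)
    (solve 3 (λ x y z → z :* y :- z :* x := z :* (y :- x)) refl x y z)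

  *-monoʳ-≤ : ∀ {x y z} → 0# ≤ z → x ≤ y → x * z ≤ y * z
  *-monoʳ-≤ {x} {y} {z} 0≤z x≤y = ≤-cert (0≤Δ x≤y *≥0 0≤z)
    (solve 3 (λ x y z → y :* z :- x :* z := (y :- x) :* z) refl x y z)

  *-monoˡ-< : ∀ {x y z} → 0# < z → x < y → z * x < z * y
  *-monoˡ-< {x} {y} {z} 0<z x<y = <-cert (0<z *>0 0<Δ x<y)
    (solve 3 (λ x y z → z :* y :- z :* x := z :* (y :- x)) refl x y z)

  *-cancelˡ-≤ : ∀ {x y z} → 0# < z → z * x ≤ z * y → x ≤ y
  *-cancelˡ-≤ 0<z zx≤zy = ≮⇒≥ λ y<x → ≤⇒≯ zx≤zy (*-monoˡ-< 0<z y<x)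

  >0⇒≉0 : ∀ {x} → 0# < x → ¬ (x ≈ 0#)
  >0⇒≉0 0<x x≈0 = <-irrefl (sym x≈0) 0<x

  x*x⁻¹≈1 : ∀ {x} → 0# < x → x * x ⁻¹ ≈ 1#
  x*x⁻¹≈1 {x} 0<x = *-inverseʳ x (>0⇒≉0 0<x)

  ⁻¹-pos : ∀ {x} → 0# < x → 0# < x ⁻¹
  ⁻¹-pos {x} 0<x with <⊎≥ 0# (x ⁻¹)
  ... | inj₁ 0<x⁻¹ = 0<x⁻¹
  ... | inj₂ x⁻¹≤0 = contradiction 0<1 (≤⇒≯ (≤-cert (inj₁ 0<x *≥0 0≤Δ x⁻¹≤0)
          (trans (+-congˡ (-‿cong (sym (x*x⁻¹≈1 0<x))))
            (solve 2 (λ x y → :0 :- x :* y := x :* (:0 :- y)) refl x (x ⁻¹)))))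

  x*[y÷x]≈y : ∀ {x} y → 0# < x → x * (y ÷ x) ≈ y
  x*[y÷x]≈y {x} y 0<x = trans (solve 3 (λ x y z → x :* (y :* z) := y :* (x :* z)) refl x y (x ⁻¹))
    (trans (*-congˡ (x*x⁻¹≈1 0<x)) (*-identityʳ y))

  -- Natural powers and Bernoulli's inequality

  open SemiringExp semiring using (^-congˡ; ^-homo-*; ^-assocʳ)
  open CommutativeSemiringExp commutativeSemiring using (^-distrib-*)

  ^-nonneg : ∀ {x} → 0# ≤ x → ∀ n → 0# ≤ x ^ n
  ^-nonneg 0≤x zero    = 0≤1
  ^-nonneg 0≤x (suc n) = 0≤x *≥0 ^-nonneg 0≤x n

  ^-pos : ∀ {x} → 0# < x → ∀ n → 0# < x ^ n
  ^-pos 0<x zero    = 0<1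
  ^-pos 0<x (suc n) = 0<x *>0 ^-pos 0<x n

  ^-monoˡ-≤ : ∀ {x y} → 0# ≤ x → x ≤ y → ∀ n → x ^ n ≤ y ^ n
  ^-monoˡ-≤ 0≤x x≤y zero    = ≤-refl
  ^-monoˡ-≤ {x} {y} 0≤x x≤y (suc n) =
    ≤-cert (≤-trans 0≤x x≤y *≥0 0≤Δ (^-monoˡ-≤ 0≤x x≤y n) +≥0 0≤Δ x≤y *≥0 ^-nonneg 0≤x n)
      (solve 4 (λ x y p q → y :* q :- x :* p := y :* (q :- p) :+ (y :- x) :* p)
        refl x y (x ^ n) (y ^ n))

  ^-monoˡ-< : ∀ {x y} → 0# ≤ x → x < y → ∀ n → x ^ suc n < y ^ suc n
  ^-monoˡ-< {x} {y} 0≤x x<y n =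
    <-cert (0<Δ x<y *>0 ^-pos (≤-<-trans 0≤x x<y) n +>0 0≤x *≥0 0≤Δ (^-monoˡ-≤ 0≤x (inj₁ x<y) n))
      (solve 4 (λ x y p q → y :* q :- x :* p := (y :- x) :* q :+ x :* (q :- p))
        refl x y (x ^ n) (y ^ n))

  ^-cancelˡ-≤ : ∀ {x y} n → 0# ≤ y → x ^ suc n ≤ y ^ suc n → x ≤ y
  ^-cancelˡ-≤ n 0≤y x^n≤y^n = ≮⇒≥ λ y<x → ≤⇒≯ x^n≤y^n (^-monoˡ-< 0≤y y<x n)

  1^n≈1 : ∀ n → 1# ^ n ≈ 1#
  1^n≈1 zero    = refl
  1^n≈1 (suc n) = trans (*-identityˡ _) (1^n≈1 n)

  ^-≥1 : ∀ {x} → 1# ≤ x → ∀ n → 1# ≤ x ^ n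
  ^-≥1 1≤x n = ≤-respˡ-≈ (1^n≈1 n) (^-monoˡ-≤ 0≤1 1≤x n)

  ^-monoʳ-≤ : ∀ {x} → 1# ≤ x → ∀ {m n} → m ℕ.≤ n → x ^ m ≤ x ^ n
  ^-monoʳ-≤ {x} 1≤x {n = n} ℕ.z≤n       = ^-≥1 1≤x n
  ^-monoʳ-≤ {x} 1≤x (ℕ.s≤s m≤n) = *-monoˡ-≤ (≤-trans 0≤1 1≤x) (^-monoʳ-≤ 1≤x m≤n)

  bernoulli : ∀ {x} → 0# ≤ x → ∀ n → 1# + fromℕ n * (x - 1#) ≤ x ^ n
  bernoulli {x} 0≤x zero    = inj₂ (solve 1 (λ x → :1 :+ :0 :* (x :- :1) := :1) refl x)
  bernoulli {x} 0≤x (suc n) = ≤-cert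
    (0≤x *≥0 0≤Δ (bernoulli 0≤x n) +≥0 fromℕ≥0 n *≥0 square≥0 (x - 1#))
    (solve 3 (λ x n p → x :* p :- (:1 :+ (:1 :+ n) :* (x :- :1))
      := x :* (p :- (:1 :+ n :* (x :- :1))) :+ n :* ((x :- :1) :* (x :- :1)))
        refl x (fromℕ n) (x ^ n))

  -- Bernoulli's inequality for 1/x, multiplied by x^n, even gives n x^(n-1) (x - 1) on the right;
  -- the weaker factor x^n avoids the exponent n - 1.
  x^n-1≤ : ∀ {x} → 1# ≤ x → ∀ n → x ^ n - 1# ≤ fromℕ n * (x ^ n * (x - 1#))
  x^n-1≤ {x} 1≤x zero    = inj₂ (solve 1 (λ x → :1 :- :1 := :0 :* (:1 :* (x :- :1))) refl x)
  x^n-1≤ {x} 1≤x (suc n) = ≤-cert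
    (≤-trans 0≤1 1≤x *≥0 0≤Δ (x^n-1≤ 1≤x n) +≥0 0≤Δ 1≤x *≥0 0≤Δ (^-≥1 1≤x (suc n)))
    (solve 3 (λ x n p → (:1 :+ n) :* (x :* p :* (x :- :1)) :- (x :* p :- :1)
      := x :* (n :* (p :* (x :- :1)) :- (p :- :1)) :+ (x :- :1) :* (x :* p :- :1))
        refl x (fromℕ n) (x ^ n))

  -- Both sides are compared with m n T^n (T - 1). For T an N-th root this relates rational powers
  -- of T^N to each other.
  m[T^n-1]≤n*T^n[T^m-1] : ∀ {T} → 1# ≤ T → ∀ m n →
    fromℕ m * (T ^ n - 1#) ≤ fromℕ n * (T ^ n * (T ^ m - 1#))
  m[T^n-1]≤n*T^n[T^m-1] {T} 1≤T m n = ≤-cert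
    (fromℕ≥0 m *≥0 0≤Δ (x^n-1≤ 1≤T n) +≥0 fromℕ≥0 n *≥0 ^-nonneg 0≤T n *≥0 0≤Δ (bernoulli 0≤T m))
    (solve 5 (λ T m n p q → n :* (p :* (q :- :1)) :- m :* (p :- :1) :=
        m :* (n :* (p :* (T :- :1)) :- (p :- :1)) :+ n :* p :* (q :- (:1 :+ m :* (T :- :1))))
      refl T (fromℕ m) (fromℕ n) (T ^ n) (T ^ m))
    where 0≤T = ≤-trans 0≤1 1≤T

  -- These results, and root below, are abstract because with-abstraction over
  -- their values would otherwise normalise their proofs.
  abstract
    -- Completeness yields excluded middle: A holds exactly when the supremum of
    -- {0} ∪ {1 | A} is positive.
    excluded-middle : (A : Set) → Dec A
    excluded-middle A = decide (<⊎≥ 0# (sup P))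
      where
      P : Carrier → Set
      P y = y ≈ 0# ⊎ (y ≈ 1# × A)

      sup-P : IsSupremum P (sup P)
      sup-P = sup-isSupremum P (0# , inj₁ refl) (1# , λ where
        y (inj₁ y≈0)       → ≤-respˡ-≈ (sym y≈0) 0≤1
        y (inj₂ (y≈1 , _)) → inj₂ y≈1)

      decide : 0# < sup P ⊎ sup P ≤ 0# → Dec A
      decide (inj₁ 0<u) with proj₂ sup-P 0# 0<u
      ... | z , inj₁ z≈0 , 0<z     = contradiction 0<z (<-irrefl (sym z≈0))
      ... | z , inj₂ (_ , a) , 0<z = yes a
      decide (inj₂ u≤0) = no λ a → ≤⇒≯ (≤-trans (proj₁ sup-P 1# (inj₂ (refl , a))) u≤0) 0<1

    -- If the natural numbers were bounded, the successor of one above `sup P - 1#` would exceed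
    -- `sup P`. This only refutes non-existence; excluded middle turns it into a witness.
    archimedean : ∀ x → ∃[ n ] (x < fromℕ n)
    archimedean x with excluded-middle (∃[ n ] (x < fromℕ n))
    ... | yes ∃n = ∃n
    ... | no ∄n  = contradiction (proj₂ sup-P (sup P - 1#) (x-1<x (sup P)))
      λ { (_ , (n , z≈n) , u-1<z) → ≤⇒≯ (proj₁ sup-P (fromℕ (suc n)) (suc n , refl))
        (<-cert (0<Δ (<-respʳ-≈ z≈n u-1<z)) (solve 2 (λ u n → :1 :+ n :- u := n :- (u :- :1))
          refl (sup P) (fromℕ n))) }
      where
      P : Carrier → Set
      P y = ∃[ n ] (y ≈ fromℕ n)

      sup-P : IsSupremum P (sup P)
      sup-P = sup-isSupremum P (0# , 0 , refl)
        (x , λ { y (n , y≈n) → ≤-respˡ-≈ (sym y≈n) (≮⇒≥ λ x<n → ∄n (n , x<n)) })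

  -- Every limit N → ∞ below is taken in this way: an error of order C/N is multiplied by N and
  -- becomes a fixed bound.
  archimedean-≤0 : ∀ {x} C → (∀ n → fromℕ (suc n) * x ≤ C) → x ≤ 0#
  archimedean-≤0 {x} C bounded = ≮⇒≥ λ 0<x → bounded⇒⊥ 0<x (archimedean (C ÷ x))
    where
    bounded⇒⊥ : 0# < x → ¬ (∃[ n ] (C ÷ x < fromℕ n))
    bounded⇒⊥ 0<x (n , C/x<n) = ≤⇒≯ (bounded n) (<-cert
      (0<x *>0 0<Δ C/x<n +>0 inj₁ 0<x)
      (trans (+-congˡ (-‿cong (sym (x*[y÷x]≈y C 0<x))))
        (solve 3 (λ x n c → (:1 :+ n) :* x :- x :* c := x :* (n :- c) :+ x)
          refl x (fromℕ n) (C ÷ x))))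

  abstract
    floor-nonneg : ∀ {x} → 0# ≤ x → ∃[ p ] (fromℕ p ≤ x × x < fromℕ (suc p))
    floor-nonneg {x} 0≤x = below (proj₁ (archimedean x)) (proj₂ (archimedean x))
      where
      below : ∀ n → x < fromℕ n → ∃[ p ] (fromℕ p ≤ x × x < fromℕ (suc p))
      below zero    x<0 = contradiction x<0 (≤⇒≯ 0≤x)
      below (suc n) x<n+1 with <⊎≥ x (fromℕ n)
      ... | inj₁ x<n = below n x<n
      ... | inj₂ n≤x = n , n≤x , x<n+1

    floor : ∀ x → ∃[ p ] ∃[ q ] (fromℕ p - fromℕ q ≤ x × x < fromℕ (suc p) - fromℕ q)
    floor x with archimedean (- x)
    ... | q , -x<q with floor-nonneg
        (≤-respʳ-≈ (solve 2 (λ x q → q :- :- x := x :+ q) refl x (fromℕ q)) (inj₁ (0<Δ -x<q)))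
    ... | p , p≤x+q , x+q<p+1 = p , q ,
      ≤-cert (0≤Δ p≤x+q) (solve 3 (λ x p q → x :- (p :- q) := x :+ q :- p)
        refl x (fromℕ p) (fromℕ q)) ,
      <-cert (0<Δ x+q<p+1) (solve 3 (λ x p q → p :- q :- x := p :- (x :+ q))
        refl x (fromℕ (suc p)) (fromℕ q))

  -- Real powers of bases ≥ 1

  module ≤-Reasoning = StrictPartialOrderReasoning strictPartialOrder

  -- t = b^x, for b ≥ 1: comparing t with b^r is comparing x with r, for every
  -- rational r = (p - q)/(1 + n).
  record IsPower (b x t : Carrier) : Set where
    field
      nonneg : 0# ≤ t
      lower  : ∀ p q n → fromℕ p - fromℕ q ≤ fromℕ (suc n) * x → b ^ p ≤ t ^ suc n * b ^ q
      upper  : ∀ p q n → fromℕ (suc n) * x ≤ fromℕ p - fromℕ q → t ^ suc n * b ^ q ≤ b ^ p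

  open IsPower

  -- Compare t with the integer power b^(p - q), where p - q is the floor of x.
  IsPower-pos : ∀ {b x t} → 1# ≤ b → IsPower b x t → 0# < t
  IsPower-pos {b} {x} {t} 1≤b isPow with <⊎≥ 0# t | floor x
  ... | inj₁ 0<t | _                   = 0<t
  ... | inj₂ t≤0 | p , q , p-q≤x , _ = contradiction (^-pos 0<b p) (≤⇒≯ (≤-trans b^p≤t*b^q t*b^q≤0))
    where
    0<b : 0# < b
    0<b = <-≤-trans 0<1 1≤b

    b^p≤t*b^q : b ^ p ≤ t ^ 1 * b ^ q
    b^p≤t*b^q = lower isPow p q 0 (≤-respʳ-≈ (solve 1 (λ x → x := (:1 :+ :0) :* x) refl x) p-q≤x)

    t*b^q≤0 : t ^ 1 * b ^ q ≤ 0#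
    t*b^q≤0 = ≤-cert (0≤-x t≤0 *≥0 ^-nonneg (inj₁ 0<b) q)
      (solve 2 (λ t b → :0 :- t :* :1 :* b := :- t :* b) refl t (b ^ q))

  module _ {b b′ x x′ t : Carrier} (b≈b′ : b ≈ b′) (x≈x′ : x ≈ x′) where

    IsPower-resp-≈ : IsPower b x t → IsPower b′ x′ t
    IsPower-resp-≈ isPow = record
      { nonneg = nonneg isPow
      ; lower  = λ p q n p-q≤Nx → ≤-respˡ-≈ (^-congˡ p b≈b′) (≤-respʳ-≈ (*-congˡ (^-congˡ q b≈b′))
          (lower isPow p q n (≤-respʳ-≈ (*-congˡ (sym x≈x′)) p-q≤Nx)))
      ; upper  = λ p q n Nx≤p-q → ≤-respˡ-≈ (*-congˡ (^-congˡ q b≈b′)) (≤-respʳ-≈ (^-congˡ p b≈b′)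
          (upper isPow p q n (≤-respˡ-≈ (*-congˡ (sym x≈x′)) Nx≤p-q)))
      }

  -- Let k be the floor of N x. Then t^N ≥ b^k and u^N ≤ b^(k+1), so (u/t)^N ≤ b for every N.
  -- Bernoulli's inequality makes N (u/t - 1) bounded, whence u/t ≤ 1.
  IsPower-≤ : ∀ {b x t u} → 1# ≤ b → IsPower b x t → IsPower b x u → u ≤ t
  IsPower-≤ {b} {x} {t} {u} 1≤b isPow-t isPow-u =
    ≤-cert (inj₁ 0<t *≥0 0≤Δ (archimedean-≤0 b N[ρ-1]≤b))
      (trans (+-congˡ (-‿cong (sym (x*[y÷x]≈y u 0<t))))
        (solve 2 (λ t ρ → t :- t :* ρ := t :* (:0 :- (ρ :- :1))) refl t ρ))
    where
    0<t = IsPower-pos 1≤b isPow-t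
    0<b = <-≤-trans 0<1 1≤b
    ρ   = u ÷ t

    ρ^N≤b : ∀ n → ρ ^ suc n ≤ b
    ρ^N≤b n with floor (fromℕ (suc n) * x)
    ... | p , q , p-q≤Nx , Nx<p+1-q = *-cancelˡ-≤ (^-pos 0<t (suc n) *>0 ^-pos 0<b q) (begin
      t ^ suc n * b ^ q * ρ ^ suc n
        ≈⟨ solve 3 (λ x y z → x :* y :* z := x :* z :* y) refl (t ^ suc n) (b ^ q) (ρ ^ suc n) ⟩
      t ^ suc n * ρ ^ suc n * b ^ q     ≈⟨ *-congʳ (^-distrib-* t ρ (suc n)) ⟨
      (t * ρ) ^ suc n * b ^ q           ≈⟨ *-congʳ (^-congˡ (suc n) (x*[y÷x]≈y u 0<t)) ⟩
      u ^ suc n * b ^ q                 ≤⟨ upper isPow-u (suc p) q n (inj₁ Nx<p+1-q) ⟩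
      b * b ^ p                         ≤⟨ *-monoˡ-≤ (inj₁ 0<b) (lower isPow-t p q n p-q≤Nx) ⟩
      b * (t ^ suc n * b ^ q)           ≈⟨ *-comm _ _ ⟩
      t ^ suc n * b ^ q * b             ∎)
      where open ≤-Reasoning

    N[ρ-1]≤b : ∀ n → fromℕ (suc n) * (ρ - 1#) ≤ b
    N[ρ-1]≤b n = ≤-cert
      (0≤1 +≥0 0≤Δ (ρ^N≤b n) +≥0 0≤Δ (bernoulli (nonneg isPow-u *≥0 inj₁ (⁻¹-pos 0<t)) (suc n)))
      (solve 4 (λ b N ρ p → b :- N :* (ρ :- :1) := :1 :+ (b :- p) :+ (p :- (:1 :+ N :* (ρ :- :1))))
        refl b (fromℕ (suc n)) ρ (ρ ^ suc n))

  IsPower-unique : ∀ {b x t u} → 1# ≤ b → IsPower b x t → IsPower b x u → t ≈ u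
  IsPower-unique 1≤b isPow-t isPow-u = ≤-antisym (IsPower-≤ 1≤b isPow-u isPow-t)
    (IsPower-≤ 1≤b isPow-t isPow-u)

  IsPower-* : ∀ {a b x t u} → 0# ≤ a → 0# ≤ b → IsPower a x t → IsPower b x u →
    IsPower (a * b) x (t * u)
  IsPower-* {a} {b} {x} {t} {u} 0≤a 0≤b isPow-t isPow-u = record
    { nonneg = nonneg isPow-t *≥0 nonneg isPow-u
    ; lower  = λ p q n p-q≤Nx → begin
        (a * b) ^ p                                     ≈⟨ ^-distrib-* a b p ⟩
        a ^ p * b ^ p
          ≤⟨ *-mono-≤ (^-nonneg 0≤a p) (^-nonneg 0≤b p) (lower isPow-t p q n p-q≤Nx)
            (lower isPow-u p q n p-q≤Nx) ⟩
        t ^ suc n * a ^ q * (u ^ suc n * b ^ q)         ≈⟨ regroup q n ⟨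
        (t * u) ^ suc n * (a * b) ^ q                   ∎
    ; upper  = λ p q n Nx≤p-q → begin
        (t * u) ^ suc n * (a * b) ^ q                   ≈⟨ regroup q n ⟩
        t ^ suc n * a ^ q * (u ^ suc n * b ^ q)
          ≤⟨ *-mono-≤ (^-nonneg (nonneg isPow-t) (suc n) *≥0 ^-nonneg 0≤a q)
            (^-nonneg (nonneg isPow-u) (suc n) *≥0 ^-nonneg 0≤b q) (upper isPow-t p q n Nx≤p-q)
              (upper isPow-u p q n Nx≤p-q) ⟩
        a ^ p * b ^ p                                   ≈⟨ ^-distrib-* a b p ⟨
        (a * b) ^ p                                     ∎
    }
    where
    open ≤-Reasoning

    *-mono-≤ : ∀ {w x y z} → 0# ≤ w → 0# ≤ y → w ≤ x → y ≤ z → w * y ≤ x * z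
    *-mono-≤ {w} {x} {y} {z} 0≤w 0≤y w≤x y≤z =
      ≤-cert (≤-trans 0≤w w≤x *≥0 0≤Δ y≤z +≥0 0≤Δ w≤x *≥0 0≤y)
      (solve 4 (λ w x y z → x :* z :- w :* y := x :* (z :- y) :+ (x :- w) :* y) refl w x y z)

    regroup : ∀ q n → (t * u) ^ suc n * (a * b) ^ q ≈ t ^ suc n * a ^ q * (u ^ suc n * b ^ q)
    regroup q n = trans (*-cong (^-distrib-* t u (suc n)) (^-distrib-* a b q))
      (solve 4 (λ t u a b → t :* u :* (a :* b) := t :* a :* (u :* b))
        refl (t ^ suc n) (u ^ suc n) (a ^ q) (b ^ q))

  IsPower-+1 : ∀ {b x t} → 0# ≤ b → IsPower b x t → IsPower b (x + 1#) (t * b)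
  IsPower-+1 {b} {x} {t} 0≤b isPow = record
    { nonneg = nonneg isPow *≥0 0≤b
    ; lower  = λ p q n p-q≤N[x+1] → ≤-respʳ-≈ (regroup q n)
      (lower isPow p (suc n ℕ.+ q) n (≤-cert (0≤Δ p-q≤N[x+1])
        (trans (+-congˡ (-‿cong (+-congˡ (-‿cong (fromℕ-+ (suc n) q)))))
          (solve 4 (λ x p q N → N :* x :- (p :- (N :+ q)) := N :* (x :+ :1) :- (p :- q))
            refl x (fromℕ p) (fromℕ q) (fromℕ (suc n))))))
    ; upper  = λ p q n N[x+1]≤p-q → ≤-respˡ-≈ (regroup q n)
      (upper isPow p (suc n ℕ.+ q) n (≤-cert (0≤Δ N[x+1]≤p-q)
        (trans (+-congʳ (+-congˡ (-‿cong (fromℕ-+ (suc n) q))))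
          (solve 4 (λ x p q N → p :- (N :+ q) :- N :* x := p :- q :- N :* (x :+ :1))
            refl x (fromℕ p) (fromℕ q) (fromℕ (suc n))))))
    }
    where
    regroup : ∀ q n → t ^ suc n * b ^ (suc n ℕ.+ q) ≈ (t * b) ^ suc n * b ^ q
    regroup q n = trans (*-congˡ (^-homo-* b (suc n) q))
      (trans (sym (*-assoc _ _ _)) (*-congʳ (sym (^-distrib-* t b (suc n)))))

  IsPower-≥1 : ∀ {b x t} → 0# ≤ x → IsPower b x t → 1# ≤ t
  IsPower-≥1 {b} {x} {t} 0≤x isPow = ≤-respʳ-≈ (solve 1 (λ t → t :* :1 :* :1 := t) refl t)
    (lower isPow 0 0 0 (≤-cert 0≤x (solve 1 (λ x → (:1 :+ :0) :* x :- (:0 :- :0) := x) refl x)))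

  -- For a positive rational r, comparing b with t^r is comparing t with b^(1/r), so numerator and
  -- denominator trade places. Exponents r ≤ 0 are trivial in `lower′` and impossible in `upper′`,
  -- where r ≥ y > 0. This is what recovers X from R.
  IsPower-inverse : ∀ {b x y t} → 1# ≤ b → 0# < x → x * y ≈ 1# → IsPower b x t → IsPower t y b
  IsPower-inverse {b} {x} {y} {t} 1≤b 0<x xy≈1 isPow = record
    { nonneg = 0≤b
    ; lower  = lower′
    ; upper  = upper′
    }
    where
    open ≤-Reasoning
    0≤b = ≤-trans 0≤1 1≤b
    1≤t = IsPower-≥1 (inj₁ 0<x) isPow

    x*[z*y]≈z : ∀ z → x * (z * y) ≈ z
    x*[z*y]≈z z = trans (solve 3 (λ x y z → x :* (z :* y) := z :* (x :* y)) refl x y z)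
      (trans (*-congˡ xy≈1) (*-identityʳ z))

    0<y : 0# < y
    0<y with <⊎≥ 0# y
    ... | inj₁ 0<y = 0<y
    ... | inj₂ y≤0 = contradiction 0<1 (≤⇒≯ (≤-respˡ-≈ xy≈1 (≤-cert (inj₁ 0<x *≥0 0≤-x y≤0)
            (solve 2 (λ x y → :0 :- x :* y := x :* :- y) refl x y))))

    difference : ∀ q j → fromℕ (suc q ℕ.+ j) - fromℕ q ≈ fromℕ (suc j)
    difference q j = trans (+-congʳ (fromℕ-+ (suc q) j))
      (solve 2 (λ q j → :1 :+ q :+ j :- q := :1 :+ j) refl (fromℕ q) (fromℕ j))

    split : ∀ q j → t ^ (suc q ℕ.+ j) ≈ t ^ q * t ^ suc j
    split q j = trans (^-homo-* t (suc q) j)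
      (solve 3 (λ t x y → t :* x :* y := x :* (t :* y)) refl t (t ^ q) (t ^ j))

    lower′ : ∀ p q n → fromℕ p - fromℕ q ≤ fromℕ (suc n) * y → t ^ p ≤ b ^ suc n * t ^ q
    lower′ p q n p-q≤Ny with ℕ.≤-<-connex p q
    ... | inj₁ p≤q = begin
      t ^ p                 ≤⟨ ^-monoʳ-≤ 1≤t p≤q ⟩
      t ^ q                 ≈⟨ *-identityˡ _ ⟨
      1# * t ^ q            ≤⟨ *-monoʳ-≤ (^-nonneg (≤-trans 0≤1 1≤t) q) (^-≥1 1≤b (suc n)) ⟩
      b ^ suc n * t ^ q     ∎
    ... | inj₂ q<p with ℕ.m≤n⇒∃[o]m+o≡n q<p
    ...   | j , ≡.refl = begin
      t ^ (suc q ℕ.+ j)         ≈⟨ split q j ⟩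
      t ^ q * t ^ suc j
        ≤⟨ *-monoˡ-≤ (^-nonneg (≤-trans 0≤1 1≤t) q)
          (≤-respˡ-≈ (*-identityʳ _) (upper isPow (suc n) 0 j jx≤N)) ⟩
      t ^ q * b ^ suc n         ≈⟨ *-comm _ _ ⟩
      b ^ suc n * t ^ q         ∎
      where
      jx≤N : fromℕ (suc j) * x ≤ fromℕ (suc n) - 0#
      jx≤N = ≤-respˡ-≈ (*-comm _ _)
        (≤-respʳ-≈ (trans (x*[z*y]≈z (fromℕ (suc n))) (solve 1 (λ x → x := x :- :0) refl _))
        (*-monoˡ-≤ (inj₁ 0<x) (≤-respˡ-≈ (difference q j) p-q≤Ny)))

    upper′ : ∀ p q n → fromℕ (suc n) * y ≤ fromℕ p - fromℕ q → b ^ suc n * t ^ q ≤ t ^ p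
    upper′ p q n Ny≤p-q with ℕ.≤-<-connex p q
    ... | inj₁ p≤q = contradiction (<-≤-trans (fromℕ-suc>0 n *>0 0<y) Ny≤p-q) (≤⇒≯
            (≤-cert (0≤Δ (fromℕ-mono-≤ p≤q)) (solve 2 (λ p q → :0 :- (p :- q) := q :- p)
              refl (fromℕ p) (fromℕ q))))
    ... | inj₂ q<p with ℕ.m≤n⇒∃[o]m+o≡n q<p
    ...   | j , ≡.refl = begin
      b ^ suc n * t ^ q         ≈⟨ *-comm _ _ ⟩
      t ^ q * b ^ suc n
        ≤⟨ *-monoˡ-≤ (^-nonneg (≤-trans 0≤1 1≤t) q)
          (≤-respʳ-≈ (*-identityʳ _) (lower isPow (suc n) 0 j N≤jx)) ⟩
      t ^ q * t ^ suc j         ≈⟨ split q j ⟨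
      t ^ (suc q ℕ.+ j)         ∎
      where
      N≤jx : fromℕ (suc n) - 0# ≤ fromℕ (suc j) * x
      N≤jx = ≤-respʳ-≈ (*-comm _ _)
        (≤-respˡ-≈ (trans (x*[z*y]≈z (fromℕ (suc n))) (solve 1 (λ x → x := x :- :0) refl _))
        (*-monoˡ-≤ (inj₁ 0<x) (≤-respʳ-≈ (difference q j) Ny≤p-q)))


  -- Continuity from the right with an explicit linear modulus. The recursion for C expands (u +
  -- ε)(u^n + ε C) and replaces ε² by ε.
  ^-perturb-above : ∀ {u} → 0# ≤ u → ∀ n →
    ∃[ C ] (0# ≤ C × (∀ {ε} → 0# ≤ ε → ε ≤ 1# → (u + ε) ^ n ≤ u ^ n + ε * C))
  ^-perturb-above {u} 0≤u zero = 0# , ≤-refl , λ {ε} _ _ →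
    inj₂ (solve 1 (λ ε → :1 := :1 :+ ε :* :0) refl ε)
  ^-perturb-above {u} 0≤u (suc n) with ^-perturb-above 0≤u n
  ... | C , 0≤C , bound = u ^ n + u * C + C , ^-nonneg 0≤u n +≥0 0≤u *≥0 0≤C +≥0 0≤C ,
      λ {ε} 0≤ε ε≤1 →
    ≤-cert ((0≤u +≥0 0≤ε) *≥0 0≤Δ (bound 0≤ε ε≤1) +≥0 0≤ε *≥0 0≤Δ ε≤1 *≥0 0≤C)
      (solve 5 (λ u ε C p q → u :* p :+ ε :* (p :+ u :* C :+ C) :- (u :+ ε) :* q
                 := (u :+ ε) :* (p :+ ε :* C :- q) :+ ε :* (:1 :- ε) :* C)
        refl u ε C (u ^ n) ((u + ε) ^ n))

  ^-room-above : ∀ {u A B} → 0# ≤ u → 0# < B → ∀ n → u ^ n * B < A → ∃[ t ] (u < t × t ^ n * B ≤ A)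
  ^-room-above {u} {A} {B} 0≤u 0<B n u^nB<A with ^-perturb-above 0≤u n
  ... | C , 0≤C , bound = u + ε , <-cert 0<ε (solve 2 (λ u ε → u :+ ε :- u := ε) refl u ε) ,
    ≤-cert (inj₁ 0<B *≥0 0≤Δ (bound (inj₁ 0<ε) ε≤1) +≥0 0≤d-BCε)
      (solve 6 (λ A B C ε p q → A :- q :* B
        := B :* (p :+ ε :* C :- q) :+ (A :- p :* B :- B :* C :* ε))
        refl A B C ε (u ^ n) ((u + ε) ^ n))
    where
    d = A - u ^ n * B
    E = B * C + d
    -- With this choice ε ≤ 1 and B C ε = d - d ε ≤ d.
    ε = d ÷ E

    0<d : 0# < d
    0<d = 0<Δ u^nB<A

    0<E : 0# < E
    0<E = <-respʳ-≈ (+-comm d (B * C)) (0<d +>0 inj₁ 0<B *≥0 0≤C)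

    0<ε : 0# < ε
    0<ε = 0<d *>0 ⁻¹-pos 0<E

    ε≤1 : ε ≤ 1#
    ε≤1 = *-cancelˡ-≤ 0<E (≤-respˡ-≈ (sym (x*[y÷x]≈y d 0<E))
      (≤-cert (inj₁ 0<B *≥0 0≤C) (solve 3 (λ B C d → (B :* C :+ d) :* :1 :- d := B :* C)
        refl B C d)))

    0≤d-BCε : 0# ≤ d - B * C * ε
    0≤d-BCε = ≤-respʳ-≈
      (trans (solve 4 (λ B C d ε → d :* ε := (B :* C :+ d) :* ε :- B :* C :* ε) refl B C d ε)
      (+-congʳ (x*[y÷x]≈y d 0<E))) (inj₁ 0<d *≥0 inj₁ 0<ε)

  ^-room-below : ∀ {u A B} → 0# ≤ u → 0# < B → 0# ≤ A → ∀ n → A < u ^ suc n * B →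
                 ∃[ y ] (0# ≤ y × y < u × A ≤ y ^ suc n * B)
  ^-room-below {u} {A} {B} 0≤u 0<B 0≤A n A<D = y , 0≤u *≥0 0≤Δ ε≤1 ,
    <-cert (0<u *>0 0<ε) (solve 2 (λ u ε → u :- u :* (:1 :- ε) := u :* ε) refl u ε) , A≤y^NB
    where
    N = fromℕ (suc n)
    D = u ^ suc n * B

    0<u : 0# < u
    0<u with <⊎≥ 0# u
    ... | inj₁ 0<u = 0<u
    ... | inj₂ u≤0 = contradiction A<D (≤⇒≯ (≤-trans
            (≤-cert (0≤-x u≤0 *≥0 ^-nonneg 0≤u n *≥0 inj₁ 0<B)
              (solve 3 (λ u p B → :0 :- u :* p :* B := :- u :* p :* B) refl u (u ^ n) B))
            0≤A))

    0<D : 0# < D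
    0<D = ^-pos 0<u (suc n) *>0 0<B

    0<ND : 0# < N * D
    0<ND = fromℕ-suc>0 n *>0 0<D

    -- The solution of D (1 - N ε) = A, so that Bernoulli's inequality for 1 - ε yields the bound.
    ε = (D - A) ÷ (N * D)
    y = u * (1# - ε)

    0<ε : 0# < ε
    0<ε = 0<Δ A<D *>0 ⁻¹-pos 0<ND

    ε≤1 : ε ≤ 1#
    ε≤1 = *-cancelˡ-≤ 0<ND (≤-respˡ-≈ (sym (x*[y÷x]≈y (D - A) 0<ND))
      (≤-cert (0≤A +≥0 fromℕ≥0 n *≥0 inj₁ 0<D)
        (solve 3 (λ A D n → (:1 :+ n) :* D :* :1 :- (D :- A) := A :+ n :* D) refl A D (fromℕ n))))

    A≤y^NB : A ≤ y ^ suc n * B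
    A≤y^NB = begin
      A
        ≈⟨ solve 2 (λ A D → A := D :- (D :- A)) refl A D ⟩
      D - (D - A)
        ≈⟨ +-congˡ (-‿cong (x*[y÷x]≈y (D - A) 0<ND)) ⟨
      D - N * D * ε
        ≈⟨ solve 3 (λ D N ε → D :- N :* D :* ε := D :* (:1 :+ N :* (:1 :- ε :- :1))) refl D N ε ⟩
      D * (1# + N * (1# - ε - 1#))
        ≤⟨ *-monoˡ-≤ (inj₁ 0<D) (bernoulli (0≤Δ ε≤1) (suc n)) ⟩
      u ^ suc n * B * (1# - ε) ^ suc n
        ≈⟨ solve 3 (λ x y z → x :* y :* z := x :* z :* y) refl (u ^ suc n) B ((1# - ε) ^ suc n) ⟩
      u ^ suc n * (1# - ε) ^ suc n * B
        ≈⟨ *-congʳ (^-distrib-* u (1# - ε) (suc n)) ⟨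
      y ^ suc n * B                                         ∎
      where open ≤-Reasoning

  ^-comm : ∀ x m n → (x ^ m) ^ n ≈ (x ^ n) ^ m
  ^-comm x m n =
    trans (^-assocʳ x m n) (trans (reflexive (≡.cong (x ^_) (ℕ.*-comm m n))) (sym (^-assocʳ x n m)))

  module _ {b x : Carrier} (1≤b : 1# ≤ b) where

    private
      0<b : 0# < b
      0<b = <-≤-trans 0<1 1≤b

    -- Here r′ ≤ x ≤ r for the two rational exponents. After raising to the common denominator N N′
    -- the claim reduces to an inequality between natural exponents, and `^-cancelˡ-≤` then takes
    -- the N′-th root.
    BelowPower-upper : ∀ {t} → BelowPower b x t → ∀ p q n →
      fromℕ (suc n) * x ≤ fromℕ p - fromℕ q → t ^ suc n * b ^ q ≤ b ^ p
    BelowPower-upper {t} (p′ , q′ , n′ , p′-q′≤N′x , 0≤t , t^N′b^q′≤b^p′) p q n Nx≤p-q =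
      ^-cancelˡ-≤ n′ (^-nonneg (inj₁ 0<b) p) (*-cancelˡ-≤ (^-pos (^-pos 0<b q′) N) (begin
        (b ^ q′) ^ N * (t ^ N * b ^ q) ^ N′           ≈⟨ *-congˡ (^-distrib-* (t ^ N) (b ^ q) N′) ⟩
        (b ^ q′) ^ N * ((t ^ N) ^ N′ * (b ^ q) ^ N′)  ≈⟨ *-congˡ (*-congʳ (^-comm t N N′)) ⟩
        (b ^ q′) ^ N * ((t ^ N′) ^ N * (b ^ q) ^ N′)
          ≈⟨ solve 3 (λ x y z → x :* (y :* z) := z :* (y :* x))
            refl ((b ^ q′) ^ N) ((t ^ N′) ^ N) ((b ^ q) ^ N′) ⟩
        (b ^ q) ^ N′ * ((t ^ N′) ^ N * (b ^ q′) ^ N)  ≈⟨ *-congˡ (^-distrib-* (t ^ N′) (b ^ q′) N) ⟨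
        (b ^ q) ^ N′ * (t ^ N′ * b ^ q′) ^ N
          ≤⟨ *-monoˡ-≤ (^-nonneg (^-nonneg (inj₁ 0<b) q) N′)
            (^-monoˡ-≤ (^-nonneg 0≤t N′ *≥0 ^-nonneg (inj₁ 0<b) q′) t^N′b^q′≤b^p′ N) ⟩
        (b ^ q) ^ N′ * (b ^ p′) ^ N                   ≈⟨ merge q N′ p′ N ⟩
        b ^ (q ℕ.* N′ ℕ.+ p′ ℕ.* N)                   ≤⟨ ^-monoʳ-≤ 1≤b exponents ⟩
        b ^ (q′ ℕ.* N ℕ.+ p ℕ.* N′)                   ≈⟨ merge q′ N p N′ ⟨
        (b ^ q′) ^ N * (b ^ p) ^ N′                   ∎))
      where
      open ≤-Reasoning
      N  = suc n
      N′ = suc n′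

      merge : ∀ i j k l → (b ^ i) ^ j * (b ^ k) ^ l ≈ b ^ (i ℕ.* j ℕ.+ k ℕ.* l)
      merge i j k l = trans (*-cong (^-assocʳ b i j) (^-assocʳ b k l))
        (sym (^-homo-* b (i ℕ.* j) (k ℕ.* l)))

      fromℕ-+* : ∀ i j k l → fromℕ (i ℕ.* j ℕ.+ k ℕ.* l) ≈ fromℕ i * fromℕ j + fromℕ k * fromℕ l
      fromℕ-+* i j k l = trans (fromℕ-+ (i ℕ.* j) (k ℕ.* l)) (+-cong (fromℕ-* i j) (fromℕ-* k l))

      exponents : q ℕ.* N′ ℕ.+ p′ ℕ.* N ℕ.≤ q′ ℕ.* N ℕ.+ p ℕ.* N′
      exponents = fromℕ-cancel-≤ (≤-cert
        (fromℕ≥0 N′ *≥0 0≤Δ Nx≤p-q +≥0 fromℕ≥0 N *≥0 0≤Δ p′-q′≤N′x)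
        (trans (+-cong (fromℕ-+* q′ N p N′) (-‿cong (fromℕ-+* q N′ p′ N)))
          (solve 7 (λ x p q p′ q′ N N′ → q′ :* N :+ p :* N′ :- (q :* N′ :+ p′ :* N)
                      := N′ :* (p :- q :- N :* x) :+ N :* (N′ :* x :- (p′ :- q′)))
            refl x (fromℕ p) (fromℕ q) (fromℕ p′) (fromℕ q′) (fromℕ N) (fromℕ N′))))

    0∈BelowPower : BelowPower b x 0#
    0∈BelowPower with floor x
    ... | p , q , p-q≤x , _ = p , q , 0 , ≤-respʳ-≈ (solve 1 (λ x → x := (:1 :+ :0) :* x) refl x)
        p-q≤x , ≤-refl ,
          ≤-respˡ-≈ (solve 1 (λ c → :0 := :0 :* :1 :* c) refl (b ^ q)) (^-nonneg (inj₁ 0<b) p)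

    BelowPower-bounded : ∃ (UpperBound (BelowPower b x))
    BelowPower-bounded with archimedean x
    ... | p , x<p = b ^ p , λ t below → ≤-respˡ-≈ (solve 1 (λ t → t :* :1 :* :1 := t) refl t)
          (BelowPower-upper below p 0 0
            (≤-cert (inj₁ (0<Δ x<p)) (solve 2 (λ x p → p :- :0 :- (:1 :+ :0) :* x := p :- x)
              refl x (fromℕ p))))

    -- If `lower` failed, some t above the supremum would still belong to the set. If `upper`
    -- failed, so it would at some y below the supremum, and an element of the set above y
    -- contradicts `BelowPower-upper`.
    sup-IsPower : IsPower b x (sup (BelowPower b x))
    sup-IsPower = record { nonneg = 0≤u ; lower = lower′ ; upper = upper′ }
      where
      u = sup (BelowPower b x)

      isSup : IsSupremum (BelowPower b x) u
      isSup = sup-isSupremum (BelowPower b x) (0# , 0∈BelowPower) BelowPower-bounded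

      0≤u : 0# ≤ u
      0≤u = proj₁ isSup 0# 0∈BelowPower

      lower′ : ∀ p q n → fromℕ p - fromℕ q ≤ fromℕ (suc n) * x → b ^ p ≤ u ^ suc n * b ^ q
      lower′ p q n p-q≤Nx = ≮⇒≥ λ u^Nb^q<b^p →
        let t , u<t , t^Nb^q≤b^p = ^-room-above 0≤u (^-pos 0<b q) (suc n) u^Nb^q<b^p
        in ≤⇒≯ (proj₁ isSup t (p , q , n , p-q≤Nx , ≤-trans 0≤u (inj₁ u<t) , t^Nb^q≤b^p)) u<t

      upper′ : ∀ p q n → fromℕ (suc n) * x ≤ fromℕ p - fromℕ q → u ^ suc n * b ^ q ≤ b ^ p
      upper′ p q n Nx≤p-q = ≮⇒≥ λ b^p<u^Nb^q →
        let y , 0≤y , y<u , b^p≤y^Nb^q = ^-room-below 0≤u (^-pos 0<b q) (^-nonneg (inj₁ 0<b) p) n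
              b^p<u^Nb^q
            z , z∈ , y<z = proj₂ isSup y y<u
        in ≤⇒≯ (≤-trans (BelowPower-upper z∈ p q n Nx≤p-q) b^p≤y^Nb^q)
             (<-respˡ-≈ (*-comm _ _)
               (<-respʳ-≈ (*-comm _ _) (*-monoˡ-< (^-pos 0<b q) (^-monoˡ-< 0≤y y<z n))))

    **-IsPower : IsPower b x (b ** x)
    **-IsPower with compare 0# b | compare b 1#
    ... | tri< _ _ _   | tri< b<1 _ _ = contradiction b<1 (≤⇒≯ 1≤b)
    ... | tri< _ _ _   | tri≈ _ _ _   = sup-IsPower
    ... | tri< _ _ _   | tri> _ _ _   = sup-IsPower
    ... | tri≈ ¬0<b _ _ | _           = contradiction 0<b ¬0<b
    ... | tri> ¬0<b _ _ | _           = contradiction 0<b ¬0<b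

  -- Tangents to power functions

  IsPower-rational : ∀ {b x t} → IsPower b x t → ∀ p q n → fromℕ p - fromℕ q ≈ fromℕ (suc n) * x →
    b ^ p ≈ t ^ suc n * b ^ q
  IsPower-rational isPow p q n p-q≈Nx = ≤-antisym (lower isPow p q n (inj₂ p-q≈Nx))
    (upper isPow p q n (inj₂ (sym p-q≈Nx)))

  **-pos : ∀ {b} x → 1# ≤ b → 0# < b ** x
  **-pos x 1≤b = IsPower-pos 1≤b (**-IsPower 1≤b)

  -- Laws such as `**-distrib-*` and `**-+1` follow by checking that the expected value satisfies
  -- `IsPower`.
  **-unique : ∀ {b x t} → 1# ≤ b → IsPower b x t → t ≈ b ** x
  **-unique 1≤b isPow = IsPower-unique 1≤b isPow (**-IsPower 1≤b)

  **-congˡ : ∀ {a b} x → 1# ≤ a → a ≈ b → a ** x ≈ b ** x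
  **-congˡ x 1≤a a≈b = **-unique (≤-respʳ-≈ a≈b 1≤a) (IsPower-resp-≈ a≈b refl (**-IsPower 1≤a))

  **-distrib-* : ∀ {a b c} x → 1# ≤ a → 1# ≤ b → a * b ≈ c → 1# ≤ c → c ** x ≈ a ** x * b ** x
  **-distrib-* x 1≤a 1≤b ab≈c 1≤c = sym (**-unique 1≤c (IsPower-resp-≈ ab≈c refl
    (IsPower-* (≤-trans 0≤1 1≤a) (≤-trans 0≤1 1≤b) (**-IsPower 1≤a) (**-IsPower 1≤b))))

  **-+1 : ∀ {b x y} → 1# ≤ b → x + 1# ≈ y → b ** y ≈ b ** x * b
  **-+1 1≤b x+1≈y =
    sym (**-unique 1≤b (IsPower-resp-≈ refl x+1≈y (IsPower-+1 (≤-trans 0≤1 1≤b) (**-IsPower 1≤b))))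

  abstract
    root : ∀ {b} → 1# ≤ b → ∀ n → ∃[ T ] (1# ≤ T × T ^ suc n ≈ b)
    root {b} 1≤b n = b ** (1# ÷ N) ,
      IsPower-≥1 (0≤1 *≥0 inj₁ (⁻¹-pos (fromℕ-suc>0 n))) (**-IsPower 1≤b) ,
      (begin
        T ^ suc n           ≈⟨ *-identityʳ _ ⟨
        T ^ suc n * b ^ 0
          ≈⟨ IsPower-rational (**-IsPower 1≤b) 1 0 n
            (trans (solve 0 (:1 :+ :0 :- :0 := :1) refl) (sym (x*[y÷x]≈y 1# (fromℕ-suc>0 n)))) ⟨
        b ^ 1               ≈⟨ *-identityʳ b ⟩
        b                   ∎)
      where
      open ≈-Reasoning

      N T : Carrier
      N = fromℕ (suc n)
      T = b ** (1# ÷ N)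

  module _ {b α t : Carrier} (1≤b : 1# ≤ b) (1≤α : 1# ≤ α) (isPow : IsPower b α t) where

    private
      0<b : 0# < b
      0<b = <-≤-trans 0<1 1≤b

      abstract
        -- Since α ≥ 1, the floor of N α can be written N + m. The factor b then splits off from
        -- b^((N + m)/N), leaving T^m.
        floor-≥ : ∀ n →
          ∃[ m ] (fromℕ (suc n ℕ.+ m) ≤ fromℕ (suc n) * α × fromℕ (suc n) * α <
            fromℕ (suc (suc n ℕ.+ m)))
        floor-≥ n with floor-nonneg (fromℕ≥0 (suc n) *≥0 ≤-trans 0≤1 1≤α)
        ... | k , k≤Nα , Nα<k+1 with ℕ.≤-<-connex (suc n) k
        ...   | inj₂ k<N = contradiction Nα<k+1 (≤⇒≯ (≤-trans (fromℕ-mono-≤ k<N)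
                  (≤-respˡ-≈ (*-identityʳ _) (*-monoˡ-≤ (fromℕ≥0 (suc n)) 1≤α))))
        ...   | inj₁ N≤k with ℕ.m≤n⇒∃[o]m+o≡n N≤k
        ...     | m , ≡.refl = m , k≤Nα , Nα<k+1

      root-power : ∀ {T} n → T ^ suc n ≈ b → ∀ m → b ^ (suc n ℕ.+ m) ≈ (b * T ^ m) ^ suc n
      root-power {T} n T^N≈b m = begin
        b ^ (suc n ℕ.+ m)                     ≈⟨ ^-homo-* b (suc n) m ⟩
        b ^ suc n * b ^ m                     ≈⟨ *-congˡ (^-congˡ m T^N≈b) ⟨
        b ^ suc n * (T ^ suc n) ^ m           ≈⟨ *-congˡ (^-comm T (suc n) m) ⟩
        b ^ suc n * (T ^ m) ^ suc n           ≈⟨ ^-distrib-* b (T ^ m) (suc n) ⟨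
        (b * T ^ m) ^ suc n                   ∎
        where open ≈-Reasoning

    -- With T = b^(1/N) and k = ⌊Nα⌋, t ≥ b^(k/N) = T^k, and the integer
    -- exponents N ≤ k can be compared by m[T^n-1]≤n*T^n[T^m-1]; let N → ∞.
    bernoulli-lower : 1# + α * (b - 1#) ≤ t
    bernoulli-lower = ≤-cert (0≤-x (archimedean-≤0 (b - 1#) bound))
      (solve 3 (λ α b t → t :- (:1 :+ α :* (b :- :1)) := :- (:1 :+ α :* (b :- :1) :- t)) refl α b t)
      where
      bound : ∀ n → fromℕ (suc n) * (1# + α * (b - 1#) - t) ≤ b - 1#
      bound n with root 1≤b n | floor-≥ n
      ... | T , 1≤T , T^N≈b | m , k≤Nα , Nα<k+1 = ≤-cert
        (fromℕ≥0 (suc n) *≥0 0≤Δ bTᵐ≤t +≥0 0≤Δ m[b-1]≤Nb[Tᵐ-1] +≥0 0≤Δ 1≤b *≥0 0≤Δ Nα≤1+N+m)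
        (solve 6 (λ b α t N m P → b :- :1 :- N :* (:1 :+ α :* (b :- :1) :- t) :=
             N :* (t :- b :* P) :+ (N :* (b :* (P :- :1)) :- m :* (b :- :1))
               :+ (b :- :1) :* (:1 :+ (N :+ m) :- N :* α))
          refl b α t (fromℕ (suc n)) (fromℕ m) (T ^ m))
        where
        bTᵐ≤t : b * T ^ m ≤ t
        bTᵐ≤t = ^-cancelˡ-≤ n (nonneg isPow)
          (≤-respˡ-≈ (root-power n T^N≈b m) (≤-respʳ-≈ (*-identityʳ _)
          (lower isPow (suc n ℕ.+ m) 0 n
            (≤-respˡ-≈ (solve 1 (λ x → x := x :- :0) refl (fromℕ (suc n ℕ.+ m))) k≤Nα))))

        m[b-1]≤Nb[Tᵐ-1] : fromℕ m * (b - 1#) ≤ fromℕ (suc n) * (b * (T ^ m - 1#))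
        m[b-1]≤Nb[Tᵐ-1] = ≤-respˡ-≈ (*-congˡ (+-congʳ T^N≈b)) (≤-respʳ-≈ (*-congˡ (*-congʳ T^N≈b))
          (m[T^n-1]≤n*T^n[T^m-1] 1≤T m (suc n)))

        Nα≤1+N+m : fromℕ (suc n) * α ≤ 1# + (fromℕ (suc n) + fromℕ m)
        Nα≤1+N+m = ≤-respʳ-≈ (+-congˡ (fromℕ-+ (suc n) m)) (inj₁ Nα<k+1)

    -- The tangent at b, evaluated at 1 and multiplied by b. It covers points to the left of the
    -- point of contact, where `bernoulli-lower` would call for a base below 1.
    bernoulli-upper : t * (b - α * (b - 1#)) ≤ b
    bernoulli-upper = ≤-cert (0≤-x (archimedean-≤0 (t * (b - 1#)) bound))
      (solve 3 (λ α b t → b :- t :* (b :- α :* (b :- :1)) := :- (t :* (b :- α :* (b :- :1)) :- b))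
        refl α b t)
      where
      bound : ∀ n → fromℕ (suc n) * (t * (b - α * (b - 1#)) - b) ≤ t * (b - 1#)
      bound n with root 1≤b n | floor-≥ n
      ... | T , 1≤T , T^N≈b | m , k≤Nα , Nα<k+1 = ≤-cert
        (nonneg isPow *≥0 0≤Δ 1≤b *≥0 0≤Δ N+m≤Nα +≥0 0≤Δ tE≤Nb)
        (solve 5 (λ b α t N m → t :* (b :- :1) :- N :* (t :* (b :- α :* (b :- :1)) :- b) :=
             t :* (b :- :1) :* (N :* α :- (N :+ m))
               :+ (N :* b :- t :* (N :- (:1 :+ m) :* (b :- :1))))
          refl b α t N (fromℕ m))
        where
        N = fromℕ (suc n)
        E = N - fromℕ (suc m) * (b - 1#)

        t≤bTᵐ⁺¹ : t ≤ b * T ^ suc m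
        t≤bTᵐ⁺¹ = ^-cancelˡ-≤ n (inj₁ 0<b *≥0 ^-nonneg (≤-trans 0≤1 1≤T) (suc m))
          (≤-respˡ-≈ (*-identityʳ _) (≤-respʳ-≈ (root-power n T^N≈b (suc m))
            (upper isPow (suc n ℕ.+ suc m) 0 n (≤-respʳ-≈
              (trans (reflexive (≡.cong fromℕ (≡.sym (ℕ.+-suc (suc n) m))))
                (solve 1 (λ x → x := x :- :0) refl (fromℕ (suc n ℕ.+ suc m))))
              (inj₁ Nα<k+1)))))

        TᵐE≤N : T ^ suc m * E ≤ N
        TᵐE≤N = ≤-cert
          (0≤Δ (≤-respʳ-≈ (*-congˡ (*-congˡ (+-congʳ T^N≈b)))
            (m[T^n-1]≤n*T^n[T^m-1] 1≤T (suc n) (suc m))))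
          (solve 4 (λ N m b P → N :- P :* (N :- m :* (b :- :1))
            := m :* (P :* (b :- :1)) :- N :* (P :- :1))
            refl N (fromℕ (suc m)) b (T ^ suc m))

        tE≤Nb : t * E ≤ N * b
        -- The bound on t may be multiplied by E only if E ≥ 0; otherwise the left side is already
        -- nonpositive.
        tE≤Nb with ≤-total 0# E
        ... | inj₁ 0≤E = ≤-cert (0≤Δ t≤bTᵐ⁺¹ *≥0 0≤E +≥0 inj₁ 0<b *≥0 0≤Δ TᵐE≤N)
          (solve 5 (λ b t N P E → N :* b :- t :* E := (b :* P :- t) :* E :+ b :* (N :- P :* E))
            refl b t N (T ^ suc m) E)
        ... | inj₂ E≤0 = ≤-cert (nonneg isPow *≥0 0≤-x E≤0 +≥0 fromℕ≥0 (suc n) *≥0 inj₁ 0<b)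
          (solve 4 (λ b t N E → N :* b :- t :* E := t :* :- E :+ N :* b) refl b t N E)

        N+m≤Nα : N + fromℕ m ≤ N * α
        N+m≤Nα = ≤-respˡ-≈ (fromℕ-+ (suc n) m) k≤Nα

  1≤÷ : ∀ {x y} → 0# < x → x ≤ y → 1# ≤ y ÷ x
  1≤÷ {x} {y} 0<x x≤y =
    *-cancelˡ-≤ 0<x (≤-respˡ-≈ (sym (*-identityʳ x)) (≤-respʳ-≈ (sym (x*[y÷x]≈y y 0<x)) x≤y))

  module _ {α : Carrier} (1≤α : 1# ≤ α) where

    private
      F : Carrier → Carrier
      F = _** α

    -- By homogeneity only the ratio of a and b matters: `bernoulli-lower` applies to b/a, or
    -- `bernoulli-upper` to a/b, whichever is at least 1. The factor a clears the denominator of the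
    -- slope α F(a)/a.
    **-tangent-scaled : ∀ {a b} → 1# ≤ a → 1# ≤ b → F a * (a + α * (b - a)) ≤ a * F b
    **-tangent-scaled {a} {b} 1≤a 1≤b with ≤-total a b
    ... | inj₁ a≤b = ≤-cert
      (inj₁ 0<a *≥0 inj₁ (**-pos α 1≤a) *≥0 0≤Δ (bernoulli-lower 1≤ρ 1≤α (**-IsPower 1≤ρ)))
      (begin
        a * F b - F a * (a + α * (b - a))
          ≈⟨ +-cong (*-congˡ (**-distrib-* α 1≤a 1≤ρ aρ≈b 1≤b))
            (-‿cong (*-congˡ (+-congˡ (*-congˡ (+-congʳ (sym aρ≈b)))))) ⟩
        a * (F a * F ρ) - F a * (a + α * (a * ρ - a))
          ≈⟨ solve 5 (λ a α ρ p q → a :* (p :* q) :- p :* (a :+ α :* (a :* ρ :- a))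
            := a :* p :* (q :- (:1 :+ α :* (ρ :- :1)))) refl a α ρ (F a) (F ρ) ⟩
        a * F a * (F ρ - (1# + α * (ρ - 1#)))               ∎)
      where
      open ≈-Reasoning
      0<a = <-≤-trans 0<1 1≤a
      ρ = b ÷ a
      aρ≈b = x*[y÷x]≈y b 0<a
      1≤ρ = 1≤÷ 0<a a≤b
    ... | inj₂ b≤a = ≤-cert
      (inj₁ 0<b *≥0 inj₁ (**-pos α 1≤b) *≥0 0≤Δ (bernoulli-upper 1≤σ 1≤α (**-IsPower 1≤σ)))
      (begin
        a * F b - F a * (a + α * (b - a))
          ≈⟨ +-cong (*-congʳ (sym bσ≈a))
            (-‿cong (*-cong (**-distrib-* α 1≤b 1≤σ bσ≈a 1≤a)
              (+-cong (sym bσ≈a) (*-congˡ (+-congˡ (-‿cong (sym bσ≈a))))))) ⟩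
        b * σ * F b - F b * F σ * (b * σ + α * (b - b * σ))
          ≈⟨ solve 5 (λ b α σ p q → b :* σ :* p :- p :* q :* (b :* σ :+ α :* (b :- b :* σ))
            := b :* p :* (σ :- q :* (σ :- α :* (σ :- :1)))) refl b α σ (F b) (F σ) ⟩
        b * F b * (σ - F σ * (σ - α * (σ - 1#)))                        ∎)
      where
      open ≈-Reasoning
      0<b = <-≤-trans 0<1 1≤b
      σ = a ÷ b
      bσ≈a = x*[y÷x]≈y a 0<b
      1≤σ = 1≤÷ 0<b b≤a

    **-tangent : ∀ {β} → β + 1# ≈ α → ∀ {a b} → 1# ≤ a → 1# ≤ b → F a + α * a ** β * (b - a) ≤ F b
    **-tangent {β} β+1≈α {a} {b} 1≤a 1≤b = *-cancelˡ-≤ (<-≤-trans 0<1 1≤a) (≤-respˡ-≈ (begin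
      F a * (a + α * (b - a))
        ≈⟨ solve 4 (λ a b α p → p :* (a :+ α :* (b :- a)) := a :* p :+ α :* p :* (b :- a))
          refl a b α (F a) ⟩
      a * F a + α * F a * (b - a)
        ≈⟨ +-congˡ (*-congʳ (*-congˡ (**-+1 1≤a β+1≈α))) ⟩
      a * F a + α * (a ** β * a) * (b - a)
        ≈⟨ solve 5 (λ a b α p q → a :* p :+ α :* (q :* a) :* (b :- a)
          := a :* (p :+ α :* q :* (b :- a))) refl a b α (F a) (a ** β) ⟩
      a * (F a + α * a ** β * (b - a))                        ∎)
      (**-tangent-scaled 1≤a 1≤b))
      where open ≈-Reasoning

  -- A second-order upper bound from tangent inequalities

  module _ {F G : Carrier → Carrier} {l u X M : Carrier}
    (tangent : ∀ {a b} → l ≤ a → a ≤ u → l ≤ b → b ≤ u → F a + G a * (b - a) ≤ F b)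
    (slope : ∀ {a} → l ≤ a → a ≤ u → (G a - G X) * (a - X) ≤ M * ((a - X) * (a - X)))
    {x : Carrier} (l≤X : l ≤ X) (X≤u : X ≤ u) (l≤x : l ≤ x) (x≤u : x ≤ u) where

    private
      module Steps (n : ℕ) where
        N d : Carrier
        N = fromℕ (suc n)
        d = (x - X) ÷ N

        0<N : 0# < N
        0<N = fromℕ-suc>0 n

        Nd≈x-X : N * d ≈ x - X
        Nd≈x-X = x*[y÷x]≈y (x - X) 0<N

        point : ℕ → Carrier
        point j = X + fromℕ j * d

        N*point : ∀ j → N * point j ≈ N * X + fromℕ j * (x - X)
        N*point j = trans (solve 4 (λ N X j d → N :* (X :+ j :* d) := N :* X :+ j :* (N :* d))
          refl N X (fromℕ j) d)
          (+-congˡ (*-congˡ Nd≈x-X))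

        l≤point : ∀ {j} → j ℕ.≤ suc n → l ≤ point j
        l≤point {j} j≤N = *-cancelˡ-≤ 0<N (≤-respʳ-≈ (sym (N*point j))
          (≤-cert (0≤Δ (fromℕ-mono-≤ j≤N) *≥0 0≤Δ l≤X +≥0 fromℕ≥0 j *≥0 0≤Δ l≤x)
            (solve 5 (λ N X j x l → N :* X :+ j :* (x :- X) :- N :* l
              := (N :- j) :* (X :- l) :+ j :* (x :- l)) refl N X (fromℕ j) x l)))

        point≤u : ∀ {j} → j ℕ.≤ suc n → point j ≤ u
        point≤u {j} j≤N = *-cancelˡ-≤ 0<N (≤-respˡ-≈ (sym (N*point j))
          (≤-cert (0≤Δ (fromℕ-mono-≤ j≤N) *≥0 0≤Δ X≤u +≥0 fromℕ≥0 j *≥0 0≤Δ x≤u)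
            (solve 5 (λ N X j x u → N :* u :- (N :* X :+ j :* (x :- X))
              := (N :- j) :* (u :- X) :+ j :* (u :- x)) refl N X (fromℕ j) x u)))

        -- Summing the tangent inequalities at the right ends of the steps
        -- overestimates ½(jd)² by ½jd², which is negligible as N → ∞.
        F-point≤ : ∀ j → j ℕ.≤ suc n →
          fromℕ 2 * F (point j) ≤ fromℕ 2 * F X + fromℕ 2 * G X * (fromℕ j * d)
            + M * ((fromℕ j * fromℕ j + fromℕ j) * (d * d))
        F-point≤ zero j≤N = ≤-cert
          (fromℕ≥0 2 *≥0 0≤Δ (tangent (l≤point j≤N) (point≤u j≤N) l≤X X≤u))
          (solve 7 (λ X d M p q r a → con (+ 2) :* p :+ con (+ 2) :* q :* (:0 :* d)
            :+ M :* ((:0 :* :0 :+ :0) :* (d :* d)) :- con (+ 2) :* a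
                      := con (+ 2) :* (p :- (a :+ r :* (X :- (X :+ :0 :* d)))))
            refl X d M (F X) (G X) (G (point 0)) (F (point 0)))
        F-point≤ (suc j) j<N = ≤-cert
          (fromℕ≥0 2 *≥0 0≤Δ (tangent (l≤point j<N) (point≤u j<N) (l≤point j≤N) (point≤u j≤N))
            +≥0 fromℕ≥0 2 *≥0 0≤Δ slope′ +≥0 0≤Δ (F-point≤ j j≤N))
          (solve 9 (λ X d M j p q a b r →
              con (+ 2) :* p :+ con (+ 2) :* q :* ((:1 :+ j) :* d)
                :+ M :* (((:1 :+ j) :* (:1 :+ j) :+ (:1 :+ j)) :* (d :* d)) :- con (+ 2) :* a
              := con (+ 2) :* (b :- (a :+ r :* (X :+ j :* d :- (X :+ (:1 :+ j) :* d))))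
                 :+ con (+ 2) :* (M :* ((:1 :+ j) :* (d :* d)) :- (r :- q) :* d)
                 :+ (con (+ 2) :* p :+ con (+ 2) :* q :* (j :* d)
                   :+ M :* ((j :* j :+ j) :* (d :* d)) :- con (+ 2) :* b))
            refl X d M (fromℕ j) (F X) (G X) (F (point (suc j))) (F (point j)) (G (point (suc j))))
          where
          j≤N : j ℕ.≤ suc n
          j≤N = ℕ.<⇒≤ j<N

          slope′ : (G (point (suc j)) - G X) * d ≤ M * (fromℕ (suc j) * (d * d))
          -- Only the factor j + 1 of the displacement (j + 1) d is cancelled, because d may have
          -- either sign.
          slope′ = *-cancelˡ-≤ (fromℕ-suc>0 j) (≤-cert (0≤Δ (slope (l≤point j<N) (point≤u j<N)))
            (solve 6 (λ X d M J q r → J :* (M :* (J :* (d :* d))) :- J :* ((r :- q) :* d)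
                := M :* ((X :+ J :* d :- X) :* (X :+ J :* d :- X))
                  :- (r :- q) :* (X :+ J :* d :- X))
              refl X d M (fromℕ (suc j)) (G X) (G (point (suc j)))))

        F-x≤ : fromℕ 2 * F x ≤ fromℕ 2 * F X + fromℕ 2 * G X * (N * d) + M * ((N * N + N) * (d * d))
        -- F is not assumed to respect `≈`. The last point is therefore exchanged for x by the
        -- tangent at x, whose increment vanishes; the case `zero` of `F-point≤` does the same at X.
        F-x≤ = ≤-trans
          (*-monoˡ-≤ (fromℕ≥0 2)
            (≤-respˡ-≈ F-x+0≈F-x (tangent l≤x x≤u (l≤point ℕ.≤-refl) (point≤u ℕ.≤-refl))))
          (F-point≤ (suc n) ℕ.≤-refl)
          where
          F-x+0≈F-x : F x + G x * (point (suc n) - x) ≈ F x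
          F-x+0≈F-x = trans (+-congˡ (*-congˡ (+-congʳ (+-congˡ Nd≈x-X))))
            (solve 4 (λ x X p q → p :+ q :* (X :+ (x :- X) :- x) := p) refl x X (F x) (G x))

        bound : N * (fromℕ 2 * F x
          - (fromℕ 2 * F X + fromℕ 2 * G X * (x - X) + M * ((x - X) * (x - X)))) ≤
            M * ((x - X) * (x - X))
        bound = ≤-respˡ-≈
          (*-congˡ (+-congˡ (-‿cong (+-cong (+-congˡ (*-congˡ Nd≈x-X))
            (*-congˡ (*-cong Nd≈x-X Nd≈x-X))))))
          (≤-respʳ-≈ (*-congˡ (*-cong Nd≈x-X Nd≈x-X)) (≤-cert (inj₁ 0<N *≥0 0≤Δ F-x≤)
            (solve 6 (λ N d M p q a → M :* (N :* d :* (N :* d))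
              :- N :* (con (+ 2) :* a
                :- (con (+ 2) :* p :+ con (+ 2) :* q :* (N :* d) :+ M :* (N :* d :* (N :* d))))
                := N :* (con (+ 2) :* p :+ con (+ 2) :* q :* (N :* d)
                  :+ M :* ((N :* N :+ N) :* (d :* d)) :- con (+ 2) :* a))
              refl N d M (F X) (G X) (F x))))

    -- After N steps the excess is at most M (x - X)²/N. Stating `slope` with the factor a - X on
    -- both sides treats x to the left and to the right of X alike.
    taylor₂ : fromℕ 2 * F x ≤ fromℕ 2 * F X + fromℕ 2 * G X * (x - X) + M * ((x - X) * (x - X))
    taylor₂ = ≤-cert (0≤-x (archimedean-≤0 _ Steps.bound))
      (solve 2 (λ x y → y :- x := :- (x :- y)) refl _ _)

  -- Sums over finite families

  -- A is left free so that A = -1 yields the lower bound in `far-above` and A = 2 the upper bound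
  -- behind `gap`.
  sum-quadratic-≤ : ∀ {s} {f h : Fin s → Carrier} {A B C D} →
    (∀ i → A * f i ≤ B + C * h i + D * (h i * h i)) →
    A * sum f ≤ fromℕ s * B + C * sum h + D * sum (λ i → h i * h i)
  sum-quadratic-≤ {zero} {A = A} {B} {C} {D} f≤ = inj₂
    (solve 4 (λ A B C D → A :* :0 := :0 :* B :+ C :* :0 :+ D :* :0) refl A B C D)
  sum-quadratic-≤ {suc s} {f} {h} {A} {B} {C} {D} f≤ = ≤-cert
    (0≤Δ (f≤ zero) +≥0 0≤Δ (sum-quadratic-≤ (λ i → f≤ (suc i))))
    (solve 10 (λ s A B C D f₀ h₀ f h q →
        (:1 :+ s) :* B :+ C :* (h₀ :+ h) :+ D :* (h₀ :* h₀ :+ q) :- A :* (f₀ :+ f)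
        := B :+ C :* h₀ :+ D :* (h₀ :* h₀) :- A :* f₀ :+ (s :* B :+ C :* h :+ D :* q :- A :* f))
      refl (fromℕ s) A B C D (f zero) (h zero) (sum (λ i → f (suc i))) (sum (λ i → h (suc i)))
        (sum (λ i → h (suc i) * h (suc i))))

  sum-deviations : ∀ {s} (x : Fin s → ℕ) X →
    ∃[ S ] (sum (λ i → fromℕ (x i) - X) ≈ fromℕ S - fromℕ s * X)
  sum-deviations {zero}  x X = 0 , solve 1 (λ X → :0 := :0 :- :0 :* X) refl X
  sum-deviations {suc s} x X with sum-deviations (λ i → x (suc i)) X
  ... | S , eq = x zero ℕ.+ S , trans (+-congˡ eq) (trans
    (solve 4 (λ s x S X → x :- X :+ (S :- s :* X) := x :+ S :- (:1 :+ s) :* X)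
      refl (fromℕ s) (fromℕ (x zero)) (fromℕ S) X)
    (+-congʳ (sym (fromℕ-+ (x zero) S))))

  -- P and Q collect the p positive and q negative values of h.
  sum-by-signs : ∀ {s} {h : Fin s → Carrier} {Y} → (∀ i → - Y ≤ h i) → (∀ i → h i ≤ Y) →
    ∃[ p ] ∃[ q ] ∃[ P ] ∃[ Q ] (p ℕ.+ q ≡ s × P ≤ fromℕ p * Y × Q ≤ fromℕ q * Y
      × P - Q ≈ sum h × sum (λ i → h i * h i) ≤ Y * (P + Q))
  sum-by-signs {zero} {Y = Y} -Y≤h h≤Y = 0 , 0 , 0# , 0# , ≡.refl ,
    inj₂ (sym (zeroˡ Y)) , inj₂ (sym (zeroˡ Y)) , -‿inverseʳ 0# ,
      inj₂ (solve 1 (λ Y → :0 := Y :* (:0 :+ :0)) refl Y)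
  sum-by-signs {suc s} {h} {Y} -Y≤h h≤Y with sum-by-signs (λ i → -Y≤h (suc i)) (λ i → h≤Y (suc i)) |
    ≤-total 0# (h zero)
  ... | p , q , P , Q , p+q≡s , P≤pY , Q≤qY , P-Q≈Σ , Σ²≤ | inj₁ 0≤h₀ =
    suc p , q , h zero + P , Q , ≡.cong suc p+q≡s ,
    ≤-cert (0≤Δ (h≤Y zero) +≥0 0≤Δ P≤pY) (solve 4 (λ p P Y h → (:1 :+ p) :* Y :- (h :+ P)
      := Y :- h :+ (p :* Y :- P)) refl (fromℕ p) P Y (h zero)) ,
    Q≤qY ,
    trans (+-assoc _ _ _) (+-congˡ P-Q≈Σ) ,
    ≤-cert (0≤h₀ *≥0 0≤Δ (h≤Y zero) +≥0 0≤Δ Σ²≤)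
      (solve 5 (λ P Q Y h S → Y :* (h :+ P :+ Q) :- (h :* h :+ S)
        := h :* (Y :- h) :+ (Y :* (P :+ Q) :- S))
          refl P Q Y (h zero) (sum (λ i → h (suc i) * h (suc i))))
  ... | p , q , P , Q , p+q≡s , P≤pY , Q≤qY , P-Q≈Σ , Σ²≤ | inj₂ h₀≤0 =
    p , suc q , P , Q - h zero , ≡.trans (ℕ.+-suc p q) (≡.cong suc p+q≡s) , P≤pY ,
    ≤-cert (0≤Δ (-Y≤h zero) +≥0 0≤Δ Q≤qY) (solve 4 (λ q Q Y h → (:1 :+ q) :* Y :- (Q :- h)
      := h :- :- Y :+ (q :* Y :- Q)) refl (fromℕ q) Q Y (h zero)) ,
    trans (solve 3 (λ P Q h → P :- (Q :- h) := h :+ (P :- Q)) refl P Q (h zero)) (+-congˡ P-Q≈Σ) ,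
    ≤-cert (0≤-x h₀≤0 *≥0 0≤Δ (-Y≤h zero) +≥0 0≤Δ Σ²≤)
      (solve 5 (λ P Q Y h S → Y :* (P :+ (Q :- h)) :- (h :* h :+ S)
        := :- h :* (h :- :- Y) :+ (Y :* (P :+ Q) :- S))
          refl P Q Y (h zero) (sum (λ i → h (suc i) * h (suc i))))

  ≤⌊/2⌋ : ∀ {p q s} → p ℕ.+ q ≡ s → p ℕ.≤ ⌊ s /2⌋ ⊎ q ℕ.≤ ⌊ s /2⌋
  ≤⌊/2⌋ {p} {q} ≡.refl with ℕ.≤-total p q
  ... | inj₁ p≤q =
      inj₁ (ℕ.≤-trans (ℕ.≤-reflexive (ℕ.n≡⌊n+n/2⌋ p)) (ℕ.⌊n/2⌋-mono (ℕ.+-monoʳ-≤ p p≤q)))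
  ... | inj₂ q≤p =
      inj₂ (ℕ.≤-trans (ℕ.≤-reflexive (ℕ.n≡⌊n+n/2⌋ q)) (ℕ.⌊n/2⌋-mono (ℕ.+-monoˡ-≤ q q≤p)))

  -- P + Q equals both 2P - Σh and 2Q + Σh. Whichever of P and Q has at most ⌊s/2⌋ terms is bounded
  -- by ⌊s/2⌋ Y; in the second form Σh ≤ 0 permits replacing Σh by -Σh.
  sum-squares-≤ : ∀ {s} {h : Fin s → Carrier} {Y} → 0# ≤ Y → (∀ i → - Y ≤ h i) → (∀ i → h i ≤ Y) →
    sum h ≤ 0# →
    sum (λ i → h i * h i) ≤ Y * (fromℕ 2 * (fromℕ ⌊ s /2⌋ * Y) - sum h)
  sum-squares-≤ {s} {h} {Y} 0≤Y -Y≤h h≤Y Σh≤0 with sum-by-signs -Y≤h h≤Y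
  ... | p , q , P , Q , p+q≡s , P≤pY , Q≤qY , P-Q≈Σ , Σ²≤ =
      ≤-trans Σ²≤ (*-monoˡ-≤ 0≤Y (P+Q≤ (≤⌊/2⌋ p+q≡s)))
    where
    m : Carrier
    m = fromℕ ⌊ s /2⌋

    P+Q≤ : p ℕ.≤ ⌊ s /2⌋ ⊎ q ℕ.≤ ⌊ s /2⌋ → P + Q ≤ fromℕ 2 * (m * Y) - sum h
    P+Q≤ (inj₁ p≤m) = ≤-respʳ-≈ (+-congˡ (-‿cong P-Q≈Σ)) (≤-cert
      (fromℕ≥0 2 *≥0 (0≤Δ P≤pY +≥0 0≤Δ (fromℕ-mono-≤ p≤m) *≥0 0≤Y))
      (solve 5 (λ P Q p m Y → con (+ 2) :* (m :* Y) :- (P :- Q) :- (P :+ Q)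
        := con (+ 2) :* (p :* Y :- P :+ (m :- p) :* Y)) refl P Q (fromℕ p) m Y))
    P+Q≤ (inj₂ q≤m) = ≤-cert
      (fromℕ≥0 2 *≥0 (0≤Δ Q≤qY +≥0 0≤Δ (fromℕ-mono-≤ q≤m) *≥0 0≤Y) +≥0 fromℕ≥0 2 *≥0 0≤-x Σh≤0)
      (trans (+-congˡ
        (-‿cong (trans (solve 2 (λ P Q → P :+ Q := con (+ 2) :* Q :+ (P :- Q)) refl P Q)
          (+-congˡ P-Q≈Σ))))
        (solve 5 (λ Q q m Y S → con (+ 2) :* (m :* Y) :- S :- (con (+ 2) :* Q :+ S)
          := con (+ 2) :* (q :* Y :- Q :+ (m :- q) :* Y) :+ con (+ 2) :* :- S)
            refl Q (fromℕ q) m Y (sum h)))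

  -- Distance of Σxᵢ^θ from R

  x≤∣x∣ : ∀ x → x ≤ ∣ x ∣
  x≤∣x∣ x with compare x 0#
  ... | tri< x<0 _ _ = ≤-trans (inj₁ x<0) (0≤-x (inj₁ x<0))
  ... | tri≈ _ _ _   = ≤-refl
  ... | tri> _ _ _   = ≤-refl

  -x≤∣x∣ : ∀ x → - x ≤ ∣ x ∣
  -x≤∣x∣ x with compare x 0#
  ... | tri< _ _ _   = ≤-refl
  ... | tri≈ _ x≈0 _ = inj₂ (trans (-‿cong x≈0) (trans -0#≈0# (sym x≈0)))
  ... | tri> _ _ 0<x = ≤-trans (≤-cert (inj₁ 0<x) (solve 1 (λ x → :0 :- :- x := x) refl x))
      (inj₁ 0<x)

  b≤b**α : ∀ {b α} → 1# ≤ b → 1# ≤ α → b ≤ b ** α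
  b≤b**α {b} {α} 1≤b 1≤α =
    ≤-cert (0≤Δ (bernoulli-lower 1≤b 1≤α (**-IsPower 1≤b)) +≥0 0≤Δ 1≤α *≥0 0≤Δ 1≤b)
    (solve 3 (λ b α p → p :- b := p :- (:1 :+ α :* (b :- :1)) :+ (α :- :1) :* (b :- :1))
      refl b α (b ** α))

  x-1+1≈x : ∀ x → x - 1# + 1# ≈ x
  x-1+1≈x = solve 1 (λ x → x :- :1 :+ :1 := x) refl

  **-monoˡ-< : ∀ {a b α} → 1# ≤ α → 1# ≤ a → a < b → a ** α < b ** α
  **-monoˡ-< {a} {b} {α} 1≤α 1≤a a<b = <-≤-trans
    (<-cert (<-≤-trans 0<1 1≤α *>0 **-pos (α - 1#) 1≤a *>0 0<Δ a<b)
      (solve 2 (λ p d → p :+ d :- p := d) refl (a ** α) (α * a ** (α - 1#) * (b - a))))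
    (**-tangent 1≤α (x-1+1≈x α) 1≤a (≤-trans 1≤a (inj₁ a<b)))

  -- The tangents to x^(β+1) at a and at b, each evaluated at the other point, add up to (β + 1)(b -
  -- a)(b^β - a^β) ≥ 0. This includes β < 1, where x^β is not convex; θ - 2 may be such an exponent.
  **-monoˡ-≤ : ∀ {a b β} → 0# ≤ β → 1# ≤ a → a ≤ b → a ** β ≤ b ** β
  **-monoˡ-≤ {a} {b} {β} 0≤β 1≤a (inj₂ a≈b) = inj₂ (**-congˡ β 1≤a a≈b)
  **-monoˡ-≤ {a} {b} {β} 0≤β 1≤a (inj₁ a<b) = *-cancelˡ-≤ (0<α *>0 0<Δ a<b) (≤-cert
    (0≤Δ (**-tangent 1≤α refl 1≤a 1≤b) +≥0 0≤Δ (**-tangent 1≤α refl 1≤b 1≤a))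
    (solve 7 (λ a b α p q u v → α :* (b :- a) :* v :- α :* (b :- a) :* u
        := q :- (p :+ α :* u :* (b :- a)) :+ (p :- (q :+ α :* v :* (a :- b))))
      refl a b α (a ** α) (b ** α) (a ** β) (b ** β)))
    where
    α = β + 1#
    1≤b = ≤-trans 1≤a (inj₁ a<b)
    1≤α = ≤-cert 0≤β (solve 1 (λ β → β :+ :1 :- :1 := β) refl β)
    0<α = <-≤-trans 0<1 1≤α

  module _ {θ τ : Carrier} (2<θ : fromℕ 2 < θ) where

    private
      1≤θ-1 : 1# ≤ θ - 1#
      1≤θ-1 = ≤-cert (inj₁ (0<Δ 2<θ)) (solve 1 (λ θ → θ :- :1 :- :1 := θ :- con (+ 2)) refl θ)

      0≤θ-1 : 0# ≤ θ - 1#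
      0≤θ-1 = ≤-trans 0≤1 1≤θ-1

      0≤θ-2 : 0# ≤ θ - fromℕ 2
      0≤θ-2 = inj₁ (0<Δ 2<θ)

      1≤θ : 1# ≤ θ
      1≤θ = ≤-cert 0≤θ-1 refl

      0<θ : 0# < θ
      0<θ = <-≤-trans 0<1 1≤θ

      0≤θ : 0# ≤ θ
      0≤θ = inj₁ 0<θ

      F G H : Carrier → Carrier
      F = _** θ
      G = _** (θ - 1#)
      H = _** (θ - 1# - 1#)

      F-tangent : ∀ {a b} → 1# ≤ a → 1# ≤ b → F a + θ * G a * (b - a) ≤ F b
      F-tangent = **-tangent 1≤θ (x-1+1≈x θ)

      G-tangent : ∀ {a b} → 1# ≤ a → 1# ≤ b → G a + (θ - 1#) * H a * (b - a) ≤ G b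
      G-tangent = **-tangent 1≤θ-1 (x-1+1≈x (θ - 1#))

    -- The slope bound comes from the tangent to G at the larger of a and X. Its slope is at most (θ
    -- - 1) H(u), since H is increasing for θ > 2.
    **-taylor₂ : ∀ {u X x} → 1# ≤ X → X ≤ u → 1# ≤ x → x ≤ u →
      fromℕ 2 * F x ≤ fromℕ 2 * F X + fromℕ 2 * (θ * G X) * (x - X)
        + θ * (θ - 1#) * H u * ((x - X) * (x - X))
    **-taylor₂ {u} {X} 1≤X X≤u 1≤x x≤u = taylor₂ {F} {λ a → θ * G a}
      (λ 1≤a _ 1≤b _ → F-tangent 1≤a 1≤b) slope 1≤X X≤u 1≤x x≤u
      where
      H≤ : ∀ {a} → 1# ≤ a → a ≤ u → H a ≤ H u
      H≤ = **-monoˡ-≤ (≤-respʳ-≈ (solve 1 (λ θ → θ :- con (+ 2) := θ :- :1 :- :1) refl θ) 0≤θ-2)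

      slope : ∀ {a} → 1# ≤ a → a ≤ u → (θ * G a - θ * G X) * (a - X) ≤
        θ * (θ - 1#) * H u * ((a - X) * (a - X))
      slope {a} 1≤a a≤u with ≤-total X a
      ... | inj₁ X≤a = ≤-cert
        (0≤θ *≥0 0≤Δ X≤a *≥0 0≤Δ (G-tangent 1≤a 1≤X)
          +≥0 0≤θ *≥0 0≤θ-1 *≥0 0≤Δ (H≤ 1≤a a≤u) *≥0 square≥0 (a - X))
        (solve 7 (λ θ X a p q r w → θ :* (θ :- :1) :* w :* ((a :- X) :* (a :- X))
          :- (θ :* q :- θ :* p) :* (a :- X)
            := θ :* (a :- X) :* (p :- (q :+ (θ :- :1) :* r :* (X :- a)))
              :+ θ :* (θ :- :1) :* (w :- r) :* ((a :- X) :* (a :- X)))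
          refl θ X a (G X) (G a) (H a) (H u))
      ... | inj₂ a≤X = ≤-cert
        (0≤θ *≥0 0≤Δ a≤X *≥0 0≤Δ (G-tangent 1≤X 1≤a)
          +≥0 0≤θ *≥0 0≤θ-1 *≥0 0≤Δ (H≤ 1≤X X≤u) *≥0 square≥0 (a - X))
        (solve 7 (λ θ X a p q r w → θ :* (θ :- :1) :* w :* ((a :- X) :* (a :- X))
          :- (θ :* q :- θ :* p) :* (a :- X)
            := θ :* (X :- a) :* (q :- (p :+ (θ :- :1) :* r :* (a :- X)))
              :+ θ :* (θ :- :1) :* (w :- r) :* ((a :- X) :* (a :- X)))
          refl θ X a (G X) (G a) (H X) (H u))

    module _ {s : ℕ} {X Y δ R : Carrier} (j : ℕ) (x : Fin s → ℕ)
      (0<δ : 0# < δ) (δ≤1 : δ ≤ 1#) (1≤X : 1# ≤ X) (0≤Y : 0# ≤ Y)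
      (R≈sFX : R ≈ fromℕ s * F X) (sX≈j-δ : fromℕ s * X ≈ fromℕ j - δ)
      (energy : fromℕ ⌊ s /2⌋ * (θ - 1#) * (Y * Y) ≈ (1# - fromℕ 2 * δ) * X)
      (4θY≤δX : fromℕ 4 * (θ * Y) ≤ δ * X) (τ≤δX : τ ≤ δ * X)
      (0<x : ∀ i → 0 ℕ.< x i) (X-Y≤x : ∀ i → X - Y ≤ fromℕ (x i))
        (x≤X+Y : ∀ i → fromℕ (x i) ≤ X + Y) where

      private
        h : Fin s → Carrier
        h i = fromℕ (x i) - X

        -- `Z` will bound `Σh²`, and W D ≤ G(X) will eliminate `W`. What is left, θ G(X) Q, is the
        -- lower bound for 2D(R - `ΣF`) in the case of negative `Σh`.
        ΣF Σh Σh² m W L D Z Q : Carrier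
        ΣF  = sum (λ i → F (fromℕ (x i)))
        Σh  = sum h
        Σh² = sum (λ i → h i * h i)
        m   = fromℕ ⌊ s /2⌋
        W   = H (X + Y)
        L   = - Σh
        D   = X - (θ - fromℕ 2) * Y
        Z   = Y * (fromℕ 2 * (m * Y) + L)
        Q   = fromℕ 2 * L * D - (θ - 1#) * Z

        0≤X : 0# ≤ X
        0≤X = ≤-trans 0≤1 1≤X

        0≤δ : 0# ≤ δ
        0≤δ = inj₁ 0<δ

        1≤x : ∀ i → 1# ≤ fromℕ (x i)
        1≤x i = ≤-respˡ-≈ (+-identityʳ 1#) (fromℕ-mono-≤ (0<x i))

        X≤GX : X ≤ G X
        X≤GX = b≤b**α 1≤X 1≤θ-1

        0≤GX : 0# ≤ G X
        0≤GX = ≤-trans 0≤X X≤GX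

        X≤X+Y : X ≤ X + Y
        X≤X+Y = ≤-cert 0≤Y (solve 2 (λ X Y → X :+ Y :- X := Y) refl X Y)

        far-above : δ ≤ Σh → τ ≤ ΣF - R
        far-above δ≤Σh = ≤-cert
          (0≤Δ (sum-quadratic-≤ {f = λ i → F (fromℕ (x i))} {h} { - 1#} { - F X} { - (θ * G X)} {0#}
            (λ i → ≤-cert
            (0≤Δ (F-tangent 1≤X (1≤x i)))
            (solve 4 (λ p q d f → :- p :+ :- q :* d :+ :0 :* (d :* d) :- (:- :1 :* f)
              := f :- (p :+ q :* d)) refl (F X) (θ * G X) (h i) (F (fromℕ (x i))))))
            +≥0 0≤θ *≥0 0≤GX *≥0 0≤Δ δ≤Σh +≥0 0≤θ-1 *≥0 0≤GX *≥0 0≤δ +≥0 0≤Δ X≤GX *≥0 0≤δ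
              +≥0 0≤Δ τ≤δX)
          (trans (+-congʳ (+-congˡ (-‿cong R≈sFX)))
            (solve 10 (λ θ τ δ X s f p q d e → f :- s :* p :- τ :=
                (s :* :- p :+ :- (θ :* q) :* d :+ :0 :* e) :- (:- :1 :* f) :+ θ :* q :* (d :- δ)
                  :+ (θ :- :1) :* q :* δ :+ (q :- X) :* δ :+ (δ :* X :- τ))
              refl θ τ δ X (fromℕ s) ΣF (F X) (G X) Σh Σh²))

        -- The tangent to G at X + Y, evaluated at X: up to the factor X/D → 1, the
        -- second derivative at X + Y is bounded by its value at X.
        WD≤GX : W * D ≤ G X
        WD≤GX = ≤-respˡ-≈ (trans (+-congʳ (**-+1 1≤X+Y (x-1+1≈x (θ - 1#))))
            (solve 4 (λ θ X Y w → w :* (X :+ Y) :+ (θ :- :1) :* w :* (X :- (X :+ Y))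
              := w :* (X :- (θ :- con (+ 2)) :* Y)) refl θ X Y W))
          (G-tangent 1≤X+Y 1≤X)
          where 1≤X+Y = ≤-trans 1≤X X≤X+Y

        0<D : 0# < D
        0<D = 3X≤4D⇒0<D (≤-cert (0≤Δ 4θY≤δX +≥0 0≤Δ δ≤1 *≥0 0≤X +≥0 fromℕ≥0 8 *≥0 0≤Y)
          (solve 4 (λ θ X Y δ → con (+ 4) :* (X :- (θ :- con (+ 2)) :* Y) :- con (+ 3) :* X
            := δ :* X :- con (+ 4) :* (θ :* Y) :+ (:1 :- δ) :* X :+ con (+ 8) :* Y) refl θ X Y δ))
          where
          3X≤4D⇒0<D : fromℕ 3 * X ≤ fromℕ 4 * D → 0# < D
          3X≤4D⇒0<D 3X≤4D with <⊎≥ 0# D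
          ... | inj₁ 0<D = 0<D
          ... | inj₂ D≤0 = contradiction (fromℕ-suc>0 2 *>0 <-≤-trans 0<1 1≤X) (≤⇒≯ (≤-trans 3X≤4D
                  (≤-cert (fromℕ≥0 4 *≥0 0≤-x D≤0) (solve 1 (λ D → :0 :- con (+ 4) :* D
                    := con (+ 4) :* :- D) refl D))))

        -- By `energy`, the part of Q without L Y is 2LX - 2(1 - 2δ)X, which equals 2δX at L = 1 -
        -- δ. The terms in L Y amount to -(3θ - 5) L Y, and 4θY ≤ δX bounds their loss by 3δLX/4.
        -- The resulting bound has slope (8 - 3δ)X/4 > 0 in L, so L = 1 - δ is the worst case.
        δX≤Q : 0# ≤ L → 1# - δ ≤ L → δ * X ≤ Q
        δX≤Q 0≤L 1-δ≤L = *-cancelˡ-≤ (fromℕ-suc>0 3) (≤-cert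
          (fromℕ≥0 3 *≥0 0≤L *≥0 0≤Δ 4θY≤δX +≥0 fromℕ≥0 20 *≥0 0≤L *≥0 0≤Y
            +≥0 (fromℕ≥0 5 +≥0 fromℕ≥0 3 *≥0 0≤Δ δ≤1) *≥0 0≤X *≥0 0≤Δ 1-δ≤L
              +≥0 0≤X *≥0 (0≤δ +≥0 fromℕ≥0 3 *≥0 (0≤δ *≥0 0≤δ)))
          (begin
            fromℕ 4 * Q - fromℕ 4 * (δ * X)
              ≈⟨ solve 6 (λ θ X Y δ L m →
                con (+ 4) :* (con (+ 2) :* L :* (X :- (θ :- con (+ 2)) :* Y)
                  :- (θ :- :1) :* (Y :* (con (+ 2) :* (m :* Y) :+ L))) :- con (+ 4) :* (δ :* X)
                   := con (+ 8) :* L :* X :- con (+ 12) :* θ :* L :* Y :+ con (+ 20) :* L :* Y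
                     :- con (+ 4) :* δ :* X :- con (+ 8) :* (m :* (θ :- :1) :* (Y :* Y)))
                       refl θ X Y δ L m ⟩
            fromℕ 8 * L * X - fromℕ 12 * θ * L * Y + fromℕ 20 * L * Y - fromℕ 4 * δ * X
              - fromℕ 8 * (m * (θ - 1#) * (Y * Y))
              ≈⟨ +-congˡ (-‿cong (*-congˡ energy)) ⟩
            fromℕ 8 * L * X - fromℕ 12 * θ * L * Y + fromℕ 20 * L * Y - fromℕ 4 * δ * X
              - fromℕ 8 * ((1# - fromℕ 2 * δ) * X)
              ≈⟨ solve 5 (λ θ X Y δ L → con (+ 8) :* L :* X :- con (+ 12) :* θ :* L :* Y
                :+ con (+ 20) :* L :* Y :- con (+ 4) :* δ :* X
                  :- con (+ 8) :* ((:1 :- con (+ 2) :* δ) :* X)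
                   := con (+ 3) :* L :* (δ :* X :- con (+ 4) :* (θ :* Y)) :+ con (+ 20) :* L :* Y
                      :+ (con (+ 5) :+ con (+ 3) :* (:1 :- δ)) :* X :* (L :- (:1 :- δ))
                        :+ X :* (δ :+ con (+ 3) :* (δ :* δ))) refl θ X Y δ L ⟩
            fromℕ 3 * L * (δ * X - fromℕ 4 * (θ * Y)) + fromℕ 20 * L * Y
              + (fromℕ 5 + fromℕ 3 * (1# - δ)) * X * (L - (1# - δ)) + X * (δ + fromℕ 3 * (δ * δ))
                ∎))
          where open ≈-Reasoning

        far-below : Σh ≤ δ - 1# → τ ≤ R - ΣF
        far-below Σh≤δ-1 = *-cancelˡ-≤ (fromℕ-suc>0 1) (≤-trans 2τ≤θδGX (*-cancelˡ-≤ 0<D D-scaled))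
          where
          1-δ≤L : 1# - δ ≤ L
          1-δ≤L = ≤-cert (0≤Δ Σh≤δ-1) (solve 2 (λ d δ → :- d :- (:1 :- δ) := δ :- :1 :- d)
            refl Σh δ)

          0≤L : 0# ≤ L
          0≤L = ≤-trans (0≤Δ δ≤1) 1-δ≤L

          Σh≤0 : Σh ≤ 0#
          Σh≤0 = ≤-cert 0≤L (solve 1 (λ d → :0 :- d := :- d) refl Σh)

          Σh²≤Z : Σh² ≤ Z
          Σh²≤Z = sum-squares-≤ 0≤Y
            (λ i → ≤-cert (0≤Δ (X-Y≤x i)) (solve 3 (λ X Y x → x :- X :- :- Y := x :- (X :- Y))
              refl X Y (fromℕ (x i))))
            (λ i → ≤-cert (0≤Δ (x≤X+Y i)) (solve 3 (λ X Y x → Y :- (x :- X) := X :+ Y :- x)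
              refl X Y (fromℕ (x i))))
            Σh≤0

          0≤W : 0# ≤ W
          0≤W = inj₁ (**-pos (θ - 1# - 1#) (≤-trans 1≤X X≤X+Y))

          0≤Z : 0# ≤ Z
          0≤Z = 0≤Y *≥0 (fromℕ≥0 2 *≥0 (fromℕ≥0 ⌊ s /2⌋ *≥0 0≤Y) +≥0 0≤L)

          gap : fromℕ 2 * (θ * G X) * L - θ * (θ - 1#) * W * Z ≤ fromℕ 2 * (R - ΣF)
          gap = ≤-cert
            (0≤Δ (sum-quadratic-≤ (λ i → **-taylor₂ 1≤X X≤X+Y (1≤x i) (x≤X+Y i)))
              +≥0 0≤θ *≥0 0≤θ-1 *≥0 0≤W *≥0 0≤Δ Σh²≤Z)
            (trans (+-congʳ (*-congˡ (+-congʳ R≈sFX)))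
              (solve 8 (λ s f p g d e M Z → con (+ 2) :* (s :* p :- f)
                :- (con (+ 2) :* g :* :- d :- M :* Z)
                  := s :* (con (+ 2) :* p) :+ con (+ 2) :* g :* d :+ M :* e :- con (+ 2) :* f
                    :+ M :* (Z :- e))
                refl (fromℕ s) ΣF (F X) (θ * G X) Σh Σh² (θ * (θ - 1#) * W) Z))

          -- Multiplication by D lets `WD≤GX` remove W. Then `δX≤Q` leaves θ G(X) δ X, and D ≤ X
          -- restores a factor D that can be cancelled.
          D-scaled : D * (θ * δ * G X) ≤ D * (fromℕ 2 * (R - ΣF))
          D-scaled = ≤-cert
            (inj₁ 0<D *≥0 0≤Δ gap +≥0 0≤θ *≥0 0≤θ-1 *≥0 0≤Z *≥0 0≤Δ WD≤GX
              +≥0 0≤θ *≥0 0≤GX *≥0 0≤Δ (δX≤Q 0≤L 1-δ≤L) +≥0 0≤θ *≥0 0≤GX *≥0 0≤δ *≥0 0≤Δ D≤X)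
            (solve 9 (λ θ δ X D g T L W Z → D :* T :- D :* (θ :* δ :* g) :=
                D :* (T :- (con (+ 2) :* (θ :* g) :* L :- θ :* (θ :- :1) :* W :* Z))
                  :+ θ :* (θ :- :1) :* Z :* (g :- W :* D)
                :+ θ :* g :* (con (+ 2) :* L :* D :- (θ :- :1) :* Z :- δ :* X)
                  :+ θ :* g :* δ :* (X :- D))
              refl θ δ X D (G X) (fromℕ 2 * (R - ΣF)) L W Z)
            where
            D≤X : D ≤ X
            D≤X = ≤-cert (0≤θ-2 *≥0 0≤Y) (solve 3 (λ θ X Y → X :- (X :- (θ :- con (+ 2)) :* Y)
              := (θ :- con (+ 2)) :* Y) refl θ X Y)

          2τ≤θδGX : fromℕ 2 * τ ≤ θ * δ * G X
          2τ≤θδGX = ≤-cert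
            (fromℕ≥0 2 *≥0 0≤Δ τ≤δX +≥0 fromℕ≥0 2 *≥0 0≤δ *≥0 0≤Δ X≤GX +≥0 0≤θ-2 *≥0 0≤δ *≥0 0≤GX)
            (solve 5 (λ θ τ δ X g → θ :* δ :* g :- con (+ 2) :* τ
              := con (+ 2) :* (δ :* X :- τ) :+ con (+ 2) :* δ :* (g :- X)
                :+ (θ :- con (+ 2)) :* δ :* g) refl θ τ δ X (G X))

      τ≤∣ΣF-R∣ : τ ≤ ∣ ΣF - R ∣
      τ≤∣ΣF-R∣ with sum-deviations x X
      ... | S , Σh≈S-sX with ℕ.≤-<-connex j S
      ...   | inj₁ j≤S = ≤-trans (far-above (≤-respʳ-≈ (sym Σh≈) (≤-cert (0≤Δ (fromℕ-mono-≤ j≤S))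
                (solve 3 (λ S j δ → S :- (j :- δ) :- δ := S :- j) refl (fromℕ S) (fromℕ j) δ))))
                  (x≤∣x∣ (ΣF - R))
        where
        Σh≈ : Σh ≈ fromℕ S - (fromℕ j - δ)
        Σh≈ = trans Σh≈S-sX (+-congˡ (-‿cong sX≈j-δ))
      ...   | inj₂ S<j = ≤-trans (far-below (≤-respˡ-≈ (sym Σh≈) (≤-cert (0≤Δ (fromℕ-mono-≤ S<j))
                (solve 3 (λ S j δ → δ :- :1 :- (S :- (j :- δ)) := j :- (:1 :+ S))
                  refl (fromℕ S) (fromℕ j) δ))))
                (≤-respˡ-≈ (solve 2 (λ f R → :- (f :- R) := R :- f) refl ΣF R) (-x≤∣x∣ (ΣF - R)))
        where
        Σh≈ : Σh ≈ fromℕ S - (fromℕ j - δ)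
        Σh≈ = trans Σh≈S-sX (+-congˡ (-‿cong sX≈j-δ))


  -- Square roots and the sequence of R

  2*½≈1 : fromℕ 2 * ½ ≈ 1#
  2*½≈1 = x*[y÷x]≈y 1# (fromℕ-suc>0 1)

  √x*√x≈x : ∀ {x} → 1# ≤ x → √ x * √ x ≈ x
  √x*√x≈x {x} 1≤x = begin
    √ x * √ x             ≈⟨ solve 1 (λ r → r :* r := r :* (r :* :1) :* :1) refl (√ x) ⟩
    √ x ^ 2 * x ^ 0
      ≈⟨ IsPower-rational (**-IsPower 1≤x) 1 0 1
        (trans (solve 0 (:1 :+ :0 :- :0 := :1) refl) (sym 2*½≈1)) ⟨
    x ^ 1                 ≈⟨ *-identityʳ x ⟩
    x                     ∎
    where open ≈-Reasoning

  x*c²<1 : ∀ {x c} → 1# ≤ x → 0# ≤ c → c < x ** (- ½) → x * (c * c) < 1#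
  x*c²<1 {x} {c} 1≤x 0≤c c<t = <-respˡ-≈ (*-congˡ (*-congˡ (*-identityʳ c))) (<-respʳ-≈ xt²≈1
    (*-monoˡ-< (<-≤-trans 0<1 1≤x) (^-monoˡ-< 0≤c c<t 1)))
    where
    xt²≈1 : x * (x ** (- ½)) ^ 2 ≈ 1#
    xt²≈1 = trans (solve 2 (λ x p → x :* p := p :* (x :* :1)) refl x ((x ** (- ½)) ^ 2))
      (sym (IsPower-rational (**-IsPower 1≤x) 0 1 1
        (trans (solve 0 (:0 :- (:1 :+ :0) := :- :1) refl)
        (trans (-‿cong (sym 2*½≈1)) (solve 2 (λ x y → :- (x :* y) := x :* :- y)
          refl (fromℕ 2) ½)))))

  module Sequence {θ τ : Carrier} (2<θ : fromℕ 2 < θ) (0<τ : 0# < τ) (s : ℕ) (2≤s : 2 ℕ.≤ s)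
    {c : Carrier} (0≤c : 0# ≤ c) (c<K^-½ : c < (fromℕ ⌊ s /2⌋ * (θ - 1#)) ** (- ½)) where

    private
      K κ δ : Carrier
      K = fromℕ ⌊ s /2⌋ * (θ - 1#)
      κ = K * (c * c)
      δ = (1# - κ) ÷ fromℕ 2

      1≤θ : 1# ≤ θ
      1≤θ = ≤-cert (0≤1 +≥0 inj₁ (0<Δ 2<θ)) (solve 1 (λ θ → θ :- :1 := :1 :+ (θ :- con (+ 2)))
        refl θ)

      0<θ : 0# < θ
      0<θ = <-≤-trans 0<1 1≤θ

      1≤s : 1# ≤ fromℕ s
      1≤s = ≤-respˡ-≈ (+-identityʳ 1#) (fromℕ-mono-≤ (ℕ.<⇒≤ 2≤s))

      0<s : 0# < fromℕ s
      0<s = <-≤-trans 0<1 1≤s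

      -- Brings K^(-1/2) within the theory of powers of bases at least 1; s ≥ 2 enters through ⌊s/2⌋
      -- ≥ 1.
      1≤K : 1# ≤ K
      1≤K = ≤-cert (0≤Δ 1≤m *≥0 0≤Δ 1≤θ +≥0 inj₁ (0<Δ 2<θ))
        (solve 2 (λ m θ → m :* (θ :- :1) :- :1 := (m :- :1) :* (θ :- :1) :+ (θ :- con (+ 2)))
          refl (fromℕ ⌊ s /2⌋) θ)
        where
        1≤m : 1# ≤ fromℕ ⌊ s /2⌋
        1≤m = ≤-respˡ-≈ (+-identityʳ 1#) (fromℕ-mono-≤ (ℕ.⌊n/2⌋-mono 2≤s))

      0≤κ : 0# ≤ κ
      0≤κ = ≤-trans 0≤1 1≤K *≥0 square≥0 c

      2δ≈1-κ : fromℕ 2 * δ ≈ 1# - κ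
      2δ≈1-κ = x*[y÷x]≈y (1# - κ) (fromℕ-suc>0 1)

      0<δ : 0# < δ
      0<δ = 0<Δ (x*c²<1 1≤K 0≤c c<K^-½) *>0 ⁻¹-pos (fromℕ-suc>0 1)

      δ≤1 : δ ≤ 1#
      δ≤1 = *-cancelˡ-≤ (fromℕ-suc>0 1) (≤-respˡ-≈ (sym 2δ≈1-κ)
        (≤-cert (0≤1 +≥0 0≤κ) (solve 1 (λ κ → con (+ 2) :* :1 :- (:1 :- κ) := :1 :+ κ) refl κ)))

      0<δδ : 0# < δ * δ
      0<δδ = 0<δ *>0 0<δ

      -- X ≥ b₁ means τ ≤ δX. X ≥ b₂ means E ≤ δ²X, which multiplied by X is the square of 4θY ≤ δX,
      -- because Y² = c²X. The sum b₁ + b₂ stands in for the maximum.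
      E b₁ b₂ : Carrier
      E  = fromℕ 16 * (θ * θ) * (c * c)
      b₁ = τ ÷ δ
      b₂ = E ÷ (δ * δ)

      0≤E : 0# ≤ E
      0≤E = fromℕ≥0 16 *≥0 square≥0 θ *≥0 square≥0 c

      threshold : ∃[ M ] (b₁ + b₂ < fromℕ M)
      threshold = archimedean (b₁ + b₂)

      J : ℕ → ℕ
      -- One of the two units pays for the subtraction of δ/s ≤ 1 in `X`, and the other keeps `X` at
      -- least 1.
      J n = 2 ℕ.+ (proj₁ threshold ℕ.+ n)

    -- sX lies δ below an integer, so Σ(xᵢ - X) is δ above an integer.
    X R : ℕ → Carrier
    X n = fromℕ (J n) - δ ÷ fromℕ s
    R n = fromℕ s * X n ** θ

    private
      sX≈sJ-δ : ∀ n → fromℕ s * X n ≈ fromℕ (s ℕ.* J n) - δ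
      sX≈sJ-δ n = trans (solve 3 (λ s j d → s :* (j :- d) := s :* j :- s :* d)
        refl (fromℕ s) (fromℕ (J n)) (δ ÷ fromℕ s))
        (+-cong (sym (fromℕ-* s (J n))) (-‿cong (x*[y÷x]≈y δ 0<s)))

      δ/s≤1 : δ ÷ fromℕ s ≤ 1#
      δ/s≤1 = *-cancelˡ-≤ 0<s
        (≤-respˡ-≈ (sym (x*[y÷x]≈y δ 0<s)) (≤-trans δ≤1 (≤-respʳ-≈ (sym (*-identityʳ _)) 1≤s)))

      1+M+n≤X : ∀ n → 1# + (fromℕ (proj₁ threshold) + fromℕ n) ≤ X n
      1+M+n≤X n = ≤-respˡ-≈ (+-congˡ (fromℕ-+ (proj₁ threshold) n)) (≤-cert (0≤Δ δ/s≤1)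
        (solve 2 (λ k d → :1 :+ (:1 :+ k) :- d :- (:1 :+ k) := :1 :- d)
          refl (fromℕ (proj₁ threshold ℕ.+ n)) (δ ÷ fromℕ s)))

      1≤X : ∀ n → 1# ≤ X n
      1≤X n = ≤-trans (≤-cert (fromℕ≥0 (proj₁ threshold) +≥0 fromℕ≥0 n)
        (solve 2 (λ M n → :1 :+ (M :+ n) :- :1 := M :+ n) refl (fromℕ (proj₁ threshold)) (fromℕ n)))
          (1+M+n≤X n)

      n≤X : ∀ n → fromℕ n ≤ X n
      n≤X n = ≤-trans (≤-cert (0≤1 +≥0 fromℕ≥0 (proj₁ threshold))
        (solve 2 (λ M n → :1 :+ (M :+ n) :- n := :1 :+ M) refl (fromℕ (proj₁ threshold)) (fromℕ n)))
          (1+M+n≤X n)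

      b₁+b₂≤X : ∀ n → b₁ + b₂ ≤ X n
      b₁+b₂≤X n = ≤-trans (inj₁ (proj₂ threshold)) (≤-trans (≤-cert (0≤1 +≥0 fromℕ≥0 n)
        (solve 2 (λ M n → :1 :+ (M :+ n) :- M := :1 :+ n) refl (fromℕ (proj₁ threshold)) (fromℕ n)))
          (1+M+n≤X n))

      τ≤δX : ∀ n → τ ≤ δ * X n
      τ≤δX n = ≤-respˡ-≈ (x*[y÷x]≈y τ 0<δ) (*-monoˡ-≤ (inj₁ 0<δ) (≤-trans
        (≤-cert (0≤E *≥0 inj₁ (⁻¹-pos 0<δδ)) (solve 2 (λ x y → x :+ y :- x := y) refl b₁ b₂))
          (b₁+b₂≤X n)))

      E≤δδX : ∀ n → E ≤ δ * δ * X n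
      E≤δδX n = ≤-respˡ-≈ (x*[y÷x]≈y E 0<δδ) (*-monoˡ-≤ (inj₁ 0<δδ) (≤-trans
        (≤-cert (inj₁ (0<τ *>0 ⁻¹-pos 0<δ)) (solve 2 (λ x y → x :+ y :- y := x) refl b₁ b₂))
          (b₁+b₂≤X n)))

    R≥0 : ∀ n → 0# ≤ R n
    R≥0 n = inj₁ (0<s *>0 **-pos θ (1≤X n))

    R-increasing : StrictlyIncreasing R
    R-increasing n = *-monoˡ-< 0<s (**-monoˡ-< 1≤θ (1≤X n) (+-monoˡ-< _ (<-cert 0<1
      (trans (+-congʳ (reflexive (≡.cong (λ k → fromℕ (2 ℕ.+ k)) (ℕ.+-suc (proj₁ threshold) n))))
        (solve 1 (λ k → :1 :+ k :- k := :1) refl (fromℕ (J n)))))))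

    R→∞ : TendsToInfinity R
    R→∞ B with archimedean B
    ... | m , B<m = m , λ n m≤n → <-≤-trans B<m
        (≤-trans (fromℕ-mono-≤ m≤n) (≤-trans (n≤X n) (≤-trans (b≤b**α (1≤X n) 1≤θ)
          (≤-cert (0≤Δ 1≤s *≥0 inj₁ (**-pos θ (1≤X n)))
            (solve 2 (λ s p → s :* p :- p := (s :- :1) :* p) refl (fromℕ s) (X n ** θ))))))

    centre≈X : ∀ n → centre s θ (R n) ≈ X n
    centre≈X n = sym (**-unique
      (≤-respʳ-≈ (sym R/s≈Xᶿ) (IsPower-≥1 (inj₁ 0<θ) (**-IsPower (1≤X n))))
      (IsPower-resp-≈ (sym R/s≈Xᶿ)
        refl (IsPower-inverse (1≤X n) 0<θ (x*[y÷x]≈y 1# 0<θ) (**-IsPower (1≤X n)))))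
      where
      R/s≈Xᶿ : R n ÷ fromℕ s ≈ X n ** θ
      R/s≈Xᶿ = trans (*-assoc _ _ _) (x*[y÷x]≈y (X n ** θ) 0<s)

    no-solution : ∀ n x → ¬ IsSolution s θ τ (R n) (c * √ (centre s θ (R n))) x
    no-solution n x (0<x , ∣ΣF-R∣<τ , near) = ≤⇒≯
      (τ≤∣ΣF-R∣ 2<θ (s ℕ.* J n) (lookup x) 0<δ δ≤1 1≤C 0≤Y
        (*-congˡ (**-congˡ θ (1≤X n) (sym C≈X)))
        (trans (*-congˡ C≈X) (sX≈sJ-δ n))
        energy 4θY≤δC
        (≤-respʳ-≈ (*-congˡ (sym C≈X)) (τ≤δX n))
        0<x (λ i → inj₁ (proj₁ (near i))) (λ i → proj₂ (near i)))
      ∣ΣF-R∣<τ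
      where
      C Y : Carrier
      C = centre s θ (R n)
      Y = c * √ C

      C≈X : C ≈ X n
      C≈X = centre≈X n

      1≤C : 1# ≤ C
      1≤C = ≤-respʳ-≈ (sym C≈X) (1≤X n)

      0≤Y : 0# ≤ Y
      0≤Y = 0≤c *≥0 inj₁ (**-pos ½ 1≤C)

      YY≈ccC : Y * Y ≈ c * c * C
      YY≈ccC = trans (solve 2 (λ c r → c :* r :* (c :* r) := c :* c :* (r :* r)) refl c (√ C))
        (*-congˡ (√x*√x≈x 1≤C))

      energy : K * (Y * Y) ≈ (1# - fromℕ 2 * δ) * C
      energy = trans (*-congˡ YY≈ccC) (trans
        (solve 3 (λ K c C → K :* (c :* c :* C) := (:1 :- (:1 :- K :* (c :* c))) :* C) refl K c C)
        (*-congʳ (+-congˡ (-‿cong (sym 2δ≈1-κ)))))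

      4θY≤δC : fromℕ 4 * (θ * Y) ≤ δ * C
      4θY≤δC = ^-cancelˡ-≤ 1 (inj₁ 0<δ *≥0 ≤-trans 0≤1 1≤C) (≤-cert
        (≤-trans 0≤1 1≤C *≥0 0≤Δ (≤-respʳ-≈ (*-congˡ (sym C≈X)) (E≤δδX n)))
        (begin
          (δ * C) ^ 2 - (fromℕ 4 * (θ * Y)) ^ 2
            ≈⟨ solve 4 (λ δ C θ Y → δ :* C :* (δ :* C :* :1)
              :- con (+ 4) :* (θ :* Y) :* (con (+ 4) :* (θ :* Y) :* :1)
                := C :* (δ :* δ :* C) :- con (+ 16) :* (θ :* θ) :* (Y :* Y)) refl δ C θ Y ⟩
          C * (δ * δ * C) - fromℕ 16 * (θ * θ) * (Y * Y)
            ≈⟨ +-congˡ (-‿cong (*-congˡ YY≈ccC)) ⟩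
          C * (δ * δ * C) - fromℕ 16 * (θ * θ) * (c * c * C)
            ≈⟨ solve 4 (λ δ C θ c → C :* (δ :* δ :* C) :- con (+ 16) :* (θ :* θ) :* (c :* c :* C)
              := C :* (δ :* δ :* C :- con (+ 16) :* (θ :* θ) :* (c :* c))) refl δ C θ c ⟩
          C * (δ * δ * C - E)                                       ∎))
        where open ≈-Reasoning

theorem2 : (ℝ : CompleteOrderedField) → let open RealNumbers ℝ in
    (θ τ : Carrier) → fromℕ 2 < θ → NonInteger θ → 0# < τ →
    (s : ℕ) → 2 ℕ.≤ s →
    (c : Carrier) → 0# ≤ c → c < (fromℕ ⌊ s /2⌋ * (θ - 1#)) ** (- ½) →
    Σ[ R ∈ (ℕ → Carrier) ]
    ((∀ n → 0# ≤ R n)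
    × StrictlyIncreasing R
    × TendsToInfinity R
    × (∀ n → N s θ τ (R n) (c * √ (centre s θ (R n))) 0))
theorem2 ℝ θ τ 2<θ _ 0<τ s 2≤s c 0≤c c<K^-½ =
  R , R≥0 , R-increasing , R→∞ , λ n →
    [] , [] , (λ x → mk⇔ (λ ()) (λ solution → contradiction solution (no-solution n x))) , ≡.refl
  where open Sequence ℝ 2<θ 0<τ s 2≤s 0≤c c<K^-½
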